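{- Let $G=(V,E)$ be a finite graph (multiple edges and loops allowed) with symmetric digraph $\Delta(G)=(V,\mathcal{A}(G))$, let $\tau_1,\tau_2:\mathcal{A}(G)\to\mathbb{C}$ be arbitrary maps, and let $$\theta(a,a')=\tau_1(a)\tau_2(a')\,\delta_{\mathfrak{h}(a)\,\mathfrak{t}(a')}-\delta_{a^{ -1}a'}\qquad(a,a'\in\mathcal{A}(G)),$$ where $\delta_{a^{ -1}a'}=1$ if $a'=a^{ -1}$ and $0$ otherwise. Let $A^\theta_G=(a_{uv})_{u,v\in V}$ and $D^\theta_G=(d_{uv})_{u,v\in V}$ with $$a_{uv}=\sum_{a\in\mathcal{A}_{uv}}\tau_1(a)\tau_2(a),\qquad d_{uv}=\delta_{uv}\sum_{a\in\mathcal{A}(G),\ \mathfrak{t}(a)=u}\tau_1(a^{ -1})\tau_2(a).$$ Then, as formal power series in $t$, $$Z_{\Delta(G)}(t;\theta)^{ -1}=(1-t^2)^{|E|-|V|}\det\!\left(I-tA^\theta_G+t^2(D^\theta_G-I)\right).$$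
   Context: The symmetric digraph $\Delta(G)$ has, for each edge $e=\{u,v\}\in E$, two arcs $a_e=(u,v)$ and $a_e'=(v,u)$ (for a loop $e=\{v,v\}$ these are two distinct loops at $v$); these two arcs are declared inverse to each other, $a_e^{ -1}=a_e'$, $(a_e')^{ -1}=a_e$, and an arc has no other inverse. $\mathfrak{t}(a),\mathfrak{h}(a)$ are tail and head of $a$, $\mathcal{A}_{uv}$ is the set of arcs with tail $u$ and head $v$. A closed path of length $k$ is a sequence of arcs $C=(c_1,\dots,c_k)$ with $\mathfrak{h}(c_i)=\mathfrak{t}(c_{i+1})$ for $1\le i<k$ and $\mathfrak{h}(c_k)=\mathfrak{t}(c_1)$; $X_k$ is the set of closed paths of length $k$. For $C\in X_k$, $\mathrm{circ}_\theta(C)=\theta(c_1,c_2)\theta(c_2,c_3)\cdots\theta(c_{k-1},c_k)\theta(c_k,c_1)$, and $N_k=\sum_{C\in X_k}\mathrm{circ}_\theta(C)$. The zeta function is $Z_{\Delta(G)}(t;\theta)=\exp\!\left(\sum_{k\ge1}\frac{N_k}{k}t^k\right)$. -}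

module Defs where

open import Algebra.Bundles using (CommutativeRing)
open import Data.Nat using (ℕ; zero; suc; _∸_)
open import Data.Fin using (Fin; toℕ; punchIn) renaming (zero to fzero; suc to fsuc)
open import Data.Fin.Properties using () renaming (_≟_ to _≟F_)
open import Data.Bool using (Bool; true; false; not; if_then_else_; _∧_)
open import Data.Bool.Properties using () renaming (_≟_ to _≟B_)
open import Data.Product using (_×_; _,_; proj₁; proj₂)
open import Data.Product.Properties using (≡-dec)
open import Data.List using (List; []; _∷_; map; concatMap; foldr; allFin)
open import Relation.Nullary.Decidable using (⌊_⌋)
open import Relation.Binary.Definitions using (DecidableEquality)

-- A finite graph G = (V,E) with V = Fin nV, E = Fin nE; multiple edges and
-- loops allowed.  Edge e has endpoints {u,v} where ends e = (u , v)
-- (the order only fixes which of the two arcs is called a_e).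
record Graph : Set where
  field
    nV nE : ℕ
    ends : Fin nE → Fin nV × Fin nV

module _ (G : Graph) where
  open Graph G

  -- Arcs of the symmetric digraph Δ(G): (e , false) = a_e = (u,v),
  -- (e , true) = a_e' = (v,u).  For a loop these are two distinct arcs.
  Arc : Set
  Arc = Fin nE × Bool

  tailA headA : Arc → Fin nV
  tailA (e , false) = proj₁ (ends e)
  tailA (e , true)  = proj₂ (ends e)
  headA (e , false) = proj₂ (ends e)
  headA (e , true)  = proj₁ (ends e)

  invA : Arc → Arc
  invA (e , b) = (e , not b)

  _≟A_ : DecidableEquality Arc
  _≟A_ = ≡-dec _≟F_ _≟B_

  allArcs : List Arc
  allArcs = concatMap (λ e → (e , false) ∷ (e , true) ∷ []) (allFin nE)

  allSeqs : ℕ → List (List Arc)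
  allSeqs zero    = [] ∷ []
  allSeqs (suc k) = concatMap (λ a → map (a ∷_) (allSeqs k)) allArcs

  isClosed : List Arc → Bool
  isClosed []       = false
  isClosed (c ∷ cs) = go c cs
    where
    go : Arc → List Arc → Bool
    go x []       = ⌊ headA x ≟F tailA c ⌋
    go x (y ∷ ys) = ⌊ headA x ≟F tailA y ⌋ ∧ go y ys

-- Everything below is over a commutative ring R in which every positive
-- integer k+1 has an inverse inv k (i.e. a ℚ-algebra, e.g. ℂ).
module Zeta {c ℓ} (R : CommutativeRing c ℓ) (inv : ℕ → CommutativeRing.Carrier R) where
  open CommutativeRing R

  fromℕ : ℕ → Carrier
  fromℕ zero    = 0#
  fromℕ (suc k) = 1# + fromℕ k

  sumL : List Carrier → Carrier
  sumL = foldr _+_ 0#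

  sumF : (n : ℕ) → (Fin n → Carrier) → Carrier
  sumF zero    f = 0#
  sumF (suc n) f = f fzero + sumF n (λ i → f (fsuc i))

  δ : Bool → Carrier
  δ b = if b then 1# else 0#

  PS : Set c
  PS = ℕ → Carrier

  infix 4 _≈ₚ_
  _≈ₚ_ : PS → PS → Set ℓ
  f ≈ₚ g = ∀ n → f n ≈ g n

  constP : Carrier → PS
  constP a zero    = a
  constP a (suc n) = 0#

  tP : PS
  tP zero          = 0#
  tP (suc zero)    = 1#
  tP (suc (suc n)) = 0#

  infixl 6 _+ₚ_ _-ₚ_
  infixl 7 _*ₚ_
  infixr 8 _^ₚ_

  _+ₚ_ : PS → PS → PS
  (f +ₚ g) n = f n + g n

  -ₚ_ : PS → PS
  (-ₚ f) n = - f n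

  _-ₚ_ : PS → PS → PS
  f -ₚ g = f +ₚ (-ₚ g)

  _*ₚ_ : PS → PS → PS
  (f *ₚ g) n = sumF (suc n) (λ i → f (toℕ i) * g (n ∸ toℕ i))

  _^ₚ_ : PS → ℕ → PS
  f ^ₚ zero  = constP 1#
  f ^ₚ suc j = f *ₚ (f ^ₚ j)

  sumFP : (n : ℕ) → (Fin n → PS) → PS
  sumFP zero    f = constP 0#
  sumFP (suc n) f = f fzero +ₚ sumFP n (λ i → f (fsuc i))

  invFact : ℕ → Carrier
  invFact zero    = 1#
  invFact (suc j) = inv j * invFact j

  -- exp f = Σ_j f^j / j!  (for f with zero constant term; the coefficient
  -- of tⁿ only receives contributions from j ≤ n)
  expP : PS → PS
  expP f n = sumF (suc n) (λ j → invFact (toℕ j) * (f ^ₚ toℕ j) n)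

  oneMinusT² : PS
  oneMinusT² = constP 1# -ₚ tP ^ₚ 2

  sgn : ℕ → Carrier
  sgn zero    = 1#
  sgn (suc j) = - sgn j

  det : (n : ℕ) → (Fin n → Fin n → PS) → PS
  det zero    M = constP 1#
  det (suc n) M = sumFP (suc n) (λ j →
    constP (sgn (toℕ j)) *ₚ M fzero j *ₚ det n (λ r s → M (fsuc r) (punchIn j s)))

  module _ (G : Graph) (τ₁ τ₂ : Arc G → Carrier) where
    open Graph G

    θ : Arc G → Arc G → Carrier
    θ a a' = τ₁ a * τ₂ a' * δ ⌊ headA G a ≟F tailA G a' ⌋
             - δ ⌊ _≟A_ G a' (invA G a) ⌋

    circ : List (Arc G) → Carrier
    circ []       = 1#
    circ (c₁ ∷ cs) = go c₁ cs
      where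
      go : Arc G → List (Arc G) → Carrier
      go x []       = θ x c₁
      go x (y ∷ ys) = θ x y * go y ys

    N : ℕ → Carrier
    N k = sumL (map (λ C → if isClosed G C then circ C else 0#) (allSeqs G k))

    logZ : PS
    logZ zero    = 0#
    logZ (suc k) = N (suc k) * inv k

    Z : PS
    Z = expP logZ

    Aθ : Fin nV → Fin nV → Carrier
    Aθ u v = sumL (map (λ a → if ⌊ tailA G a ≟F u ⌋ ∧ ⌊ headA G a ≟F v ⌋
                              then τ₁ a * τ₂ a else 0#) (allArcs G))

    Dθ : Fin nV → Fin nV → Carrier
    Dθ u v = δ ⌊ u ≟F v ⌋ * sumL (map (λ a → if ⌊ tailA G a ≟F u ⌋
                              then τ₁ (invA G a) * τ₂ a else 0#) (allArcs G))

    Mθ : Fin nV → Fin nV → PS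
    Mθ u v = constP (δ ⌊ u ≟F v ⌋) -ₚ tP *ₚ constP (Aθ u v)
             +ₚ tP ^ₚ 2 *ₚ constP (Dθ u v - δ ⌊ u ≟F v ⌋)

{-# OPTIONS --safe #-}
-- Let Θ = PQ - J be the matrix of θ, with P, Q the weighted head and tail incidence matrices and J the
-- permutation matrix of arc inversion, so that N_k = tr Θ^k.  Put X = (I - tΘ)⁻¹ and s = 1 - t².  With the
-- Euler operator E = t d/dt, the factor Z satisfies E Z = (tr X - 2|E|) Z.  Woodbury's identity gives
-- (I + tQXP) M = s I for the vertex matrix M = I - tA + t²(D - I), hence s E(det M) = tr(E M (I + tQXP)) det M
-- by Jacobi's formula, and J² = I reduces this trace to 2|E| - s tr X - 2t²|V|.  So both sides of the theorem
-- solve the same equation s E f = p f with the same constant term, and over a ℚ-algebra it has one solution.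
module Submission where

open import Defs
open import Algebra.Bundles using (CommutativeRing; RawRing)
import Algebra.Solver.Ring.AlmostCommutativeRing as ACR
open import Data.Bool using (Bool; true; false; if_then_else_; _∧_)
open import Data.Empty using (⊥-elim)
open import Data.Fin using (Fin; zero; suc; toℕ; punchIn)
open import Data.Fin.Properties using (punchInᵢ≢i) renaming (_≟_ to _≟F_; suc-injective to suc-injectiveF)
open import Data.List using (List; []; _∷_; _++_; map; concatMap; tabulate; lookup)
open import Data.List.Properties using (map-∘)
open import Data.Maybe using (Maybe; just; nothing)
open import Data.Nat as ℕ using (ℕ; zero; suc; _∸_; _≤_; _<_; z≤n; s≤s)
import Data.Nat.Properties as ℕ
open import Data.Product using (∃; _×_; _,_; proj₁; proj₂)
open import Data.Product.Properties using (≡-dec)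
open import Data.Sum using (inj₁; inj₂)
open import Data.Vec.Functional using (Vector; updateAt)
open import Data.Vec.Functional.Properties using (updateAt-updates; updateAt-minimal; updateAt-id-local; updateAt-commutes; map-updateAt)
open import Function using (_∘_; const; id)
import Level
open import Relation.Nullary using (Dec; yes; no; ¬_; contradiction)
open import Relation.Nullary.Decidable using (⌊_⌋)
open import Relation.Binary.PropositionalEquality as ≡ using (_≡_; _≢_; _≗_)

-- Since `J² = I`, the inverse of `I + tJ` is `(I - tJ) / s`; as `QP = A` and `QJP = D`, the vertex
-- matrix is `M = s (I - tQ(I + tJ)⁻¹P)`. This is the origin of `s` and of the shape of `M`, and the
-- reason why inverting `I - tΘ = (I + tJ) - tPQ` on arcs inverts `M` on vertices up to the factor
-- `s`. The usual route compares a determinant over arcs with one over vertices, which asks for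
-- product formulas, for matrices of two sizes, and for exp(tr log) as a determinant. With Euler
-- derivatives the arcs enter through traces only, and the one determinant in sight is that of `M`.
-- For it, Jacobi's formula asks just for a matrix `B` with `s E(M) = B M`, and a one-sided inverse
-- of `M` up to `s` supplies it. The price is the division by positive integers when the
-- differential equation is solved coefficient by coefficient. The exponent |E| - |V| may be
-- negative, so it is split into two truncated differences, each on its own side of the equation; no
-- power series has to be inverted.

-- A ring solver with integer coefficients

module IntegerCoefficientSolver {c ℓ} (S : CommutativeRing c ℓ) where
  open CommutativeRing S
  open import Algebra.Properties.Ring ring
  open import Algebra.Properties.AbelianGroup +-abelianGroup using (⁻¹-∙-comm)
  open import Algebra.Properties.CommutativeSemigroup +-commutativeSemigroup using (interchange)
  open import Algebra.Properties.Semiring.Mult semiring using () renaming (_×_ to _·_; ×-homo-+ to ·-homo-+; ×1-homo-* to ·1-homo-*)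
  open import Relation.Binary.Reasoning.Setoid setoid

  -- The pair (m , n) stands for the integer m - n; reduced pairs are unique representatives.
  reduce : ℕ × ℕ → ℕ × ℕ
  reduce (suc a , suc b) = reduce (a , b)
  reduce p               = p

  -- The solver cancels terms by deciding equality of coefficients, and equality in the carrier of
  -- `S` is undecidable in general; integers are decidable and map into every ring. Goals below use
  -- variables and ring operations only, so a `1#` that occurs in a goal is passed as one more
  -- variable.
  differences : RawRing _ _
  differences = record
    { Carrier = ℕ × ℕ
    ; _≈_ = ≡._≡_
    ; _+_ = λ (a , b) (a′ , b′) → reduce (a ℕ.+ a′ , b ℕ.+ b′)
    ; _*_ = λ (a , b) (a′ , b′) → reduce (a ℕ.* a′ ℕ.+ b ℕ.* b′ , a ℕ.* b′ ℕ.+ b ℕ.* a′)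
    ; -_ = λ (a , b) → (b , a)
    ; 0# = (0 , 0)
    ; 1# = (1 , 0)
    }

  ⟦_⟧ᶻ : ℕ × ℕ → Carrier
  ⟦ a , b ⟧ᶻ = a · 1# - b · 1#

  difference-+ : ∀ x y z w → (x + y) - (z + w) ≈ (x - z) + (y - w)
  difference-+ x y z w = trans (+-congˡ (sym (⁻¹-∙-comm z w))) (interchange x y (- z) (- w))

  difference-* : ∀ x y z w → (x * z + y * w) - (x * w + y * z) ≈ (x - y) * (z - w)
  difference-* x y z w = sym (begin
    (x - y) * (z - w)                                 ≈⟨ distribʳ _ _ _ ⟩
    x * (z - w) + - y * (z - w)                       ≈⟨ +-cong (distribˡ _ _ _) (distribˡ _ _ _) ⟩
    (x * z + x * - w) + (- y * z + - y * - w)         ≈⟨ +-cong (+-congˡ (sym (-‿distribʳ-* x w))) (+-cong (sym (-‿distribˡ-* y z)) (trans (sym (-‿distribˡ-* y (- w))) (trans (-‿cong (sym (-‿distribʳ-* y w))) (-‿involutive _)))) ⟩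
    (x * z + - (x * w)) + (- (y * z) + y * w)         ≈⟨ +-congˡ (+-comm _ _) ⟩
    (x * z + - (x * w)) + (y * w + - (y * z))         ≈⟨ difference-+ _ _ _ _ ⟨
    (x * z + y * w) - (x * w + y * z)                 ∎)

  ⟦reduce⟧ : ∀ p → ⟦ reduce p ⟧ᶻ ≈ ⟦ p ⟧ᶻ
  ⟦reduce⟧ (zero  , b)     = refl
  ⟦reduce⟧ (suc a , zero)  = refl
  ⟦reduce⟧ (suc a , suc b) = begin
    ⟦ reduce (a , b) ⟧ᶻ              ≈⟨ ⟦reduce⟧ (a , b) ⟩
    a · 1# - b · 1#                  ≈⟨ +-identityˡ _ ⟨
    0# + (a · 1# - b · 1#)           ≈⟨ +-congʳ (-‿inverseʳ 1#) ⟨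
    (1# - 1#) + (a · 1# - b · 1#)    ≈⟨ difference-+ _ _ _ _ ⟨
    suc a · 1# - suc b · 1#          ∎

  homomorphism : differences ACR.-Raw-AlmostCommutative⟶ ACR.fromCommutativeRing S
  homomorphism = record
    { ⟦_⟧ = ⟦_⟧ᶻ
    ; +-homo = λ (a , b) (a′ , b′) → trans (⟦reduce⟧ (a ℕ.+ a′ , b ℕ.+ b′))
        (trans (+-cong (·-homo-+ 1# a a′) (-‿cong (·-homo-+ 1# b b′))) (difference-+ _ _ _ _))
    ; *-homo = λ (a , b) (a′ , b′) → trans (⟦reduce⟧ (a ℕ.* a′ ℕ.+ b ℕ.* b′ , a ℕ.* b′ ℕ.+ b ℕ.* a′))
        (trans (+-cong (trans (·-homo-+ 1# (a ℕ.* a′) (b ℕ.* b′)) (+-cong (·1-homo-* a a′) (·1-homo-* b b′)))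
          (-‿cong (trans (·-homo-+ 1# (a ℕ.* b′) (b ℕ.* a′)) (+-cong (·1-homo-* a b′) (·1-homo-* b a′)))))
        (difference-* _ _ _ _))
    ; -‿homo = λ (a , b) → sym (trans (sym (⁻¹-∙-comm _ _)) (trans (+-congˡ (-‿involutive _)) (+-comm _ _)))
    ; 0-homo = -‿inverseʳ 0#
    ; 1-homo = trans (+-cong (+-identityʳ 1#) -0#≈0#) (+-identityʳ 1#)
    }

  equal? : ∀ p q → Maybe (⟦ p ⟧ᶻ ≈ ⟦ q ⟧ᶻ)
  equal? p q with ≡-dec ℕ._≟_ ℕ._≟_ p q
  ... | yes eq = just (reflexive (≡.cong ⟦_⟧ᶻ eq))
  ... | no _   = nothing

  open import Algebra.Solver.Ring differences (ACR.fromCommutativeRing S) homomorphism equal? public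
    using (solve; _:+_; _:*_; _:-_; :-_; _:=_)

-- Finite sums

module FiniteSum {c ℓ} (S : CommutativeRing c ℓ) where
  open CommutativeRing S hiding (zero)
  open import Algebra.Properties.Semiring.Sum semiring as Sum using (sum)
  open import Algebra.Properties.Semiring.Mult semiring using () renaming (_×_ to _·_)

  -- Opaque, so that the summand can be inferred from the sum.
  opaque
    ∑ : ∀ {n} → (Fin n → Carrier) → Carrier
    ∑ f = sum f

    ∑-empty : ∀ (f : Fin 0 → Carrier) → ∑ f ≈ 0#
    ∑-empty f = refl

    ∑-suc : ∀ {n} (f : Fin (suc n) → Carrier) → ∑ f ≈ f zero + ∑ (λ i → f (suc i))
    ∑-suc f = refl

    ∑-one : ∀ (f : Fin 1 → Carrier) → ∑ f ≈ f zero
    ∑-one f = +-identityʳ _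

    ∑-two : ∀ (f : Fin 2 → Carrier) → ∑ f ≈ f zero + f (suc zero)
    ∑-two f = +-congˡ (+-identityʳ _)

    ∑-cong : ∀ {n} {f g : Fin n → Carrier} → (∀ i → f i ≈ g i) → ∑ f ≈ ∑ g
    ∑-cong = Sum.sum-cong-≋

    ∑-const : ∀ n x → ∑ {n} (λ _ → x) ≈ n · x
    ∑-const n x = Sum.sum-replicate n

    ∑-+ : ∀ {n} (f g : Fin n → Carrier) → ∑ (λ i → f i + g i) ≈ ∑ f + ∑ g
    ∑-+ = Sum.∑-distrib-+

    ∑-swap : ∀ {m n} (f : Fin m → Fin n → Carrier) → ∑ (λ i → ∑ (λ j → f i j)) ≈ ∑ (λ j → ∑ (λ i → f i j))
    ∑-swap = Sum.∑-comm

    *-∑ : ∀ {n} x (f : Fin n → Carrier) → x * ∑ f ≈ ∑ (λ i → x * f i)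
    *-∑ = Sum.*-distribˡ-sum

    ∑-* : ∀ {n} x (f : Fin n → Carrier) → ∑ f * x ≈ ∑ (λ i → f i * x)
    ∑-* = Sum.*-distribʳ-sum

    ∑-zero : ∀ {n} (f : Fin n → Carrier) → (∀ i → f i ≈ 0#) → ∑ f ≈ 0#
    ∑-zero {n} f f≈0 = trans (Sum.sum-cong-≋ f≈0) (Sum.sum-replicate-zero n)

    ∑-single : ∀ {n} (i : Fin n) (f : Fin n → Carrier) → (∀ k → k ≢ i → f k ≈ 0#) → ∑ f ≈ f i
    ∑-single {suc n} i f f≈0 = trans (Sum.sum-remove {i = i} f)
      (trans (+-congˡ (∑-zero (λ k → f (punchIn i k)) (λ k → f≈0 _ (punchInᵢ≢i i k)))) (+-identityʳ _))

-- Determinants by Laplace expansion: multilinear and alternating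

module Determinant {c ℓ} (S : CommutativeRing c ℓ) where
  open CommutativeRing S hiding (zero)
  open import Relation.Binary.Reasoning.Setoid setoid
  open IntegerCoefficientSolver S
  open FiniteSum S

  Matrix : ℕ → Set c
  Matrix n = Vector (Vector Carrier n) n

  sign : ℕ → Carrier
  sign zero    = 1#
  sign (suc j) = - sign j

  minor : ∀ {n} → Fin (suc n) → Matrix (suc n) → Matrix n
  minor j M r s = M (suc r) (punchIn j s)

  det : ∀ n → Matrix n → Carrier
  det zero    M = 1#
  det (suc n) M = ∑ λ j → sign (toℕ j) * M zero j * det n (minor j M)

  det-cong : ∀ n {M M′ : Matrix n} → (∀ i j → M i j ≈ M′ i j) → det n M ≈ det n M′
  det-cong zero    eq = refl
  det-cong (suc n) eq = ∑-cong λ j →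
    *-cong (*-congˡ (eq zero j)) (det-cong n λ r s → eq (suc r) (punchIn j s))

  infixl 10 _[_]≔_
  _[_]≔_ : ∀ {n} → Matrix n → Fin n → Vector Carrier n → Matrix n
  M [ i ]≔ r = updateAt M i (const r)

  ≗⇒≈ : ∀ {n} {M M′ : Matrix n} → M ≗ M′ → ∀ i j → M i j ≈ M′ i j
  ≗⇒≈ eq i j = reflexive (≡.cong (λ r → r j) (eq i))

  det-minor-[]≔ : ∀ {n} (M : Matrix (suc n)) i r j →
    det n (minor j (M [ suc i ]≔ r)) ≈ det n (minor j M [ i ]≔ (r ∘ punchIn j))
  det-minor-[]≔ {n} M i r j = det-cong n (≗⇒≈ (map-updateAt {f = _∘ punchIn j} {g = const r} (λ _ → ≡.refl) (M ∘ suc) i))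

  -- Stated for a combination of any number of rows, so that a single induction over the expansion
  -- gives scaling (one row), addition (two rows), and the replacement of a row by a combination of
  -- all rows that Jacobi's formula uses.
  det-linear : ∀ {n m} (M : Matrix n) i (c : Vector Carrier m) (R : Fin m → Vector Carrier n) →
    det n (M [ i ]≔ (λ s → ∑ λ k → c k * R k s)) ≈ ∑ λ k → c k * det n (M [ i ]≔ R k)
  det-linear {suc n} M zero c R = begin
    ∑ (λ j → sign (toℕ j) * ∑ (λ k → c k * R k j) * D j)
      ≈⟨ ∑-cong (λ j → trans (*-congʳ (*-∑ _ _)) (∑-* _ _)) ⟩
    ∑ (λ j → ∑ λ k → sign (toℕ j) * (c k * R k j) * D j)
      ≈⟨ ∑-swap _ ⟩
    ∑ (λ k → ∑ λ j → sign (toℕ j) * (c k * R k j) * D j)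
      ≈⟨ ∑-cong (λ k → trans
           (∑-cong λ j → solve 4 (λ s c r d → s :* (c :* r) :* d := c :* (s :* r :* d)) refl (sign (toℕ j)) (c k) (R k j) (D j))
           (sym (*-∑ _ _))) ⟩
    ∑ (λ k → c k * det (suc n) (M [ zero ]≔ R k)) ∎
    where D = λ j → det n (minor j M)
  det-linear {suc n} M (suc i) c R = begin
    ∑ (λ j → sign (toℕ j) * M zero j * det n (minor j (M [ suc i ]≔ _)))
      ≈⟨ ∑-cong (λ j → trans
           (*-congˡ (trans (det-minor-[]≔ M i _ j) (det-linear (minor j M) i c (λ k → R k ∘ punchIn j))))
           (*-∑ _ _)) ⟩
    ∑ (λ j → ∑ λ k → sign (toℕ j) * M zero j * (c k * D j k))
      ≈⟨ ∑-swap _ ⟩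
    ∑ (λ k → ∑ λ j → sign (toℕ j) * M zero j * (c k * D j k))
      ≈⟨ ∑-cong (λ k → trans
           (∑-cong λ j → trans
             (solve 3 (λ s c d → s :* (c :* d) := c :* (s :* d)) refl (sign (toℕ j) * M zero j) (c k) (D j k))
             (*-congˡ (*-congˡ (sym (det-minor-[]≔ M i (R k) j)))))
           (sym (*-∑ _ _))) ⟩
    ∑ (λ k → c k * det (suc n) (M [ suc i ]≔ R k)) ∎
    where D = λ j k → det n (minor j M [ i ]≔ (R k ∘ punchIn j))

  []≔-cong : ∀ {n} (M : Matrix n) i {r r′ : Vector Carrier n} → (∀ s → r s ≈ r′ s) → ∀ k s → (M [ i ]≔ r) k s ≈ (M [ i ]≔ r′) k s
  []≔-cong M i {r} {r′} eq k s with k ≟F i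
  ... | yes ≡.refl = trans (≗ₛ (updateAt-updates k M)) (trans (eq s) (sym (≗ₛ (updateAt-updates k M))))
    where ≗ₛ = λ {u v : Vector Carrier _} (e : u ≡ v) → reflexive (≡.cong (λ r → r s) e)
  ... | no k≢i = reflexive (≡.cong (λ r → r s) (≡.trans (updateAt-minimal k i M k≢i) (≡.sym (updateAt-minimal k i M k≢i))))

  det-scale : ∀ {n} (M : Matrix n) i c r → det n (M [ i ]≔ (λ s → c * r s)) ≈ c * det n (M [ i ]≔ r)
  det-scale {n} M i c r = begin
    det n (M [ i ]≔ (λ s → c * r s))                 ≈⟨ det-cong n ([]≔-cong M i (λ s → ∑-one _)) ⟨
    det n (M [ i ]≔ (λ s → ∑ {1} λ k → c * r s))     ≈⟨ det-linear M i (const c) (const r) ⟩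
    ∑ {1} (λ k → c * det n (M [ i ]≔ r))             ≈⟨ ∑-one _ ⟩
    c * det n (M [ i ]≔ r)                           ∎

  det-add : ∀ {n} (M : Matrix n) i (r r′ : Vector Carrier n) →
    det n (M [ i ]≔ (λ s → r s + r′ s)) ≈ det n (M [ i ]≔ r) + det n (M [ i ]≔ r′)
  det-add {n} M i r r′ = begin
    det n (M [ i ]≔ (λ s → r s + r′ s))               ≈⟨ det-cong n ([]≔-cong M i (λ s → trans (∑-two _) (+-cong (*-identityˡ _) (*-identityˡ _)))) ⟨
    det n (M [ i ]≔ (λ s → ∑ {2} λ k → 1# * R k s))   ≈⟨ det-linear M i (const 1#) R ⟩
    ∑ {2} (λ k → 1# * det n (M [ i ]≔ R k))           ≈⟨ trans (∑-two _) (+-cong (*-identityˡ _) (*-identityˡ _)) ⟩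
    det n (M [ i ]≔ r) + det n (M [ i ]≔ r′)          ∎
    where
    R : Fin 2 → Vector Carrier n
    R zero    = r
    R (suc _) = r′

  -- Turns a selection of columns into one that also keeps column 0. The terms of the double
  -- expansion that delete two columns other than column 0 have selections of this form.
  lift : ∀ {m n} → (Fin m → Fin n) → Fin (suc m) → Fin (suc n)
  lift ψ zero    = zero
  lift ψ (suc i) = suc (ψ i)

  -- The terms (j , l) = (0 , l) and (l + 1 , 0) delete the same two columns with opposite signs;
  -- the remaining terms are an instance of the same sum one dimension lower.
  double-expansion : ∀ n (r : Vector Carrier (suc (suc n))) (φ : (Fin n → Fin (suc (suc n))) → Carrier) →
    (∀ {ψ ψ′} → ψ ≗ ψ′ → φ ψ ≈ φ ψ′) →
    (∑ λ j → ∑ λ l → (sign (toℕ j) * sign (toℕ l)) * (r j * r (punchIn j l)) * φ (punchIn j ∘ punchIn l)) ≈ 0#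
  double-expansion n r φ φ-cong = begin
    ∑ (λ j → ∑ (T j))
      ≈⟨ trans (∑-suc _) (+-congˡ (∑-cong λ j → ∑-suc _)) ⟩
    ∑ (T zero) + ∑ (λ j → T (suc j) zero + ∑ (λ l → T (suc j) (suc l)))
      ≈⟨ +-congˡ (∑-+ _ _) ⟩
    ∑ (T zero) + (∑ (λ j → T (suc j) zero) + ∑ (λ j → ∑ (λ l → T (suc j) (suc l))))
      ≈⟨ +-assoc _ _ _ ⟨
    (∑ (T zero) + ∑ (λ j → T (suc j) zero)) + ∑ (λ j → ∑ (λ l → T (suc j) (suc l)))
      ≈⟨ +-cong (trans (sym (∑-+ _ _)) (∑-zero _ cancel)) (rest n r φ φ-cong) ⟩
    0# + 0#
      ≈⟨ +-identityʳ 0# ⟩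
    0# ∎
    where
    T = λ j l → (sign (toℕ j) * sign (toℕ l)) * (r j * r (punchIn j l)) * φ (punchIn j ∘ punchIn l)
    cancel : ∀ l → T zero l + T (suc l) zero ≈ 0#
    cancel l = trans
      (solve 5 (λ e s r₀ r₁ f → (e :* s) :* (r₀ :* r₁) :* f :+ (:- s :* e) :* (r₁ :* r₀) :* f := (f :- f) :* s) refl
         1# (sign (toℕ l)) (r zero) (r (suc l)) (φ (punchIn zero ∘ punchIn l)))
      (trans (*-congʳ (-‿inverseʳ _)) (zeroˡ _))
    rest : ∀ n (r : Vector Carrier (suc (suc n))) (φ : (Fin n → Fin (suc (suc n))) → Carrier) →
      (∀ {ψ ψ′} → ψ ≗ ψ′ → φ ψ ≈ φ ψ′) →
      (∑ λ j → ∑ λ l → (- sign (toℕ j) * - sign (toℕ l)) * (r (suc j) * r (suc (punchIn j l)))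
        * φ (punchIn (suc j) ∘ punchIn (suc l))) ≈ 0#
    rest zero    r φ φ-cong = ∑-zero _ λ j → ∑-empty _
    rest (suc n) r φ φ-cong = trans
      (∑-cong λ j → ∑-cong λ l → *-cong
        (*-congʳ (solve 2 (λ x y → :- x :* :- y := x :* y) refl (sign (toℕ j)) (sign (toℕ l))))
        (φ-cong λ { zero → ≡.refl ; (suc s) → ≡.refl }))
      (double-expansion n (r ∘ suc) (φ ∘ lift) (λ eq → φ-cong λ { zero → ≡.refl ; (suc s) → ≡.cong suc (eq s) }))

  -- Expansion along both rows gives a sum over ordered pairs of deleted columns. The determinant
  -- that remains depends only on which columns are left, which is the shape that `double-expansion`
  -- sums to zero.
  det-adjacent : ∀ n (M : Matrix (suc (suc n))) → (∀ s → M zero s ≈ M (suc zero) s) → det (suc (suc n)) M ≈ 0#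
  det-adjacent n M eq = begin
    ∑ (λ j → sign (toℕ j) * M zero j * ∑ (λ l → sign (toℕ l) * M (suc zero) (punchIn j l) * φ (punchIn j ∘ punchIn l)))
      ≈⟨ ∑-cong (λ j → trans (*-∑ _ _) (∑-cong λ l → trans
           (*-congˡ (*-congʳ (*-congˡ (sym (eq _)))))
           (solve 5 (λ s r s′ r′ f → s :* r :* (s′ :* r′ :* f) := (s :* s′) :* (r :* r′) :* f) refl
             (sign (toℕ j)) (M zero j) (sign (toℕ l)) (M zero (punchIn j l)) (φ (punchIn j ∘ punchIn l))))) ⟩
    ∑ (λ j → ∑ λ l → (sign (toℕ j) * sign (toℕ l)) * (M zero j * M zero (punchIn j l)) * φ (punchIn j ∘ punchIn l))
      ≈⟨ double-expansion n (M zero) φ (λ eq → det-cong n λ i s → reflexive (≡.cong (M (suc (suc i))) (eq s))) ⟩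
    0# ∎
    where φ = λ (ψ : Fin n → Fin (suc (suc n))) → det n (λ i s → M (suc (suc i)) (ψ s))

  AlternatingIn : ∀ {n} → Fin n → Fin n → Set _
  AlternatingIn {n} i k = ∀ M → (∀ s → M i s ≈ M k s) → det n M ≈ 0#

  alternating-suc : ∀ {n} {i k : Fin n} → AlternatingIn i k → AlternatingIn (suc i) (suc k)
  alternating-suc alt M eq = ∑-zero _ λ j →
    trans (*-congˡ (alt (minor j M) (λ s → eq (punchIn j s)))) (zeroʳ _)

  -- Polarization: with `r + r′` in both rows the determinant vanishes, and it expands into four
  -- terms of which the two with equal rows vanish as well.
  det-antisymmetric : ∀ {n} (i k : Fin n) → i ≢ k → AlternatingIn i k → ∀ M r r′ →
    det n (M [ i ]≔ r [ k ]≔ r′) + det n (M [ i ]≔ r′ [ k ]≔ r) ≈ 0#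
  det-antisymmetric {n} i k i≢k alt M r r′ = begin
    D r r′ + D r′ r
      ≈⟨ +-cong (+-identityˡ _) (+-identityʳ _) ⟨
    (0# + D r r′) + (D r′ r + 0#)
      ≈⟨ +-cong (+-congʳ (equal-rows r)) (+-congˡ (equal-rows r′)) ⟨
    (D r r + D r r′) + (D r′ r + D r′ r′)
      ≈⟨ +-cong (det-add _ k r r′) (det-add _ k r r′) ⟨
    D r r+r′ + D r′ r+r′
      ≈⟨ +-cong (commute r) (commute r′) ⟩
    det n (M [ k ]≔ r+r′ [ i ]≔ r) + det n (M [ k ]≔ r+r′ [ i ]≔ r′)
      ≈⟨ det-add _ i r r′ ⟨
    det n (M [ k ]≔ r+r′ [ i ]≔ r+r′)
      ≈⟨ commute r+r′ ⟨
    D r+r′ r+r′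
      ≈⟨ equal-rows r+r′ ⟩
    0# ∎
    where
    D = λ a b → det n (M [ i ]≔ a [ k ]≔ b)
    r+r′ = λ s → r s + r′ s
    equal-rows : ∀ a → D a a ≈ 0#
    equal-rows a = alt _ λ s → reflexive (≡.cong (λ v → v s) (≡.trans
      (≡.trans (updateAt-minimal i k (M [ i ]≔ a) i≢k) (updateAt-updates i M))
      (≡.sym (updateAt-updates k (M [ i ]≔ a)))))
    -- `det-add` splits the outermost update, so row `i` has to be moved outside row `k` before it
    -- can be split.
    commute : ∀ a → D a r+r′ ≈ det n (M [ k ]≔ r+r′ [ i ]≔ a)
    commute a = sym (det-cong n (≗⇒≈ (updateAt-commutes i k i≢k M)))

  det-alternating-first : ∀ n → (∀ (i k : Fin n) → i ≢ k → AlternatingIn i k) → ∀ k → AlternatingIn {suc n} zero (suc k)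
  det-alternating-first (suc n) alt zero    M eq = det-adjacent n M eq
  -- Exchange rows 1 and k + 2 to make the equal rows adjacent.
  det-alternating-first (suc n) alt (suc k) M eq = begin
    det _ M                                       ≈⟨ det-cong (suc (suc n)) (≗⇒≈ unchanged) ⟨
    det _ (M [ p ]≔ M p [ q ]≔ M q)               ≈⟨ +-identityʳ _ ⟨
    det _ (M [ p ]≔ M p [ q ]≔ M q) + 0#          ≈⟨ +-congˡ (det-adjacent n (M [ p ]≔ M q [ q ]≔ M p) eq) ⟨
    det _ (M [ p ]≔ M p [ q ]≔ M q) + det _ (M [ p ]≔ M q [ q ]≔ M p)
      ≈⟨ det-antisymmetric p q (λ ()) (alternating-suc (alt zero (suc k) (λ ()))) M (M p) (M q) ⟩
    0# ∎
    where
    p = suc zero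
    q = suc (suc k)
    unchanged : M [ p ]≔ M p [ q ]≔ M q ≗ M
    unchanged i = ≡.trans
      (updateAt-id-local q {const (M q)} (M [ p ]≔ M p) (≡.sym (updateAt-id-local p {const (M p)} M ≡.refl q)) i)
      (updateAt-id-local p M ≡.refl i)

  det-alternating : ∀ n (i k : Fin n) → i ≢ k → AlternatingIn i k
  det-alternating (suc n) zero    zero    0≢0 = contradiction ≡.refl 0≢0
  det-alternating (suc n) (suc i) (suc k) i≢k = alternating-suc (det-alternating n i k (i≢k ∘ ≡.cong suc))
  det-alternating (suc n) zero    (suc k) _   = det-alternating-first n (det-alternating n) k
  det-alternating (suc n) (suc i) zero    _ M eq = det-alternating-first n (det-alternating n) i M (λ s → sym (eq s))

  -- Derivations and Jacobi's formula

  record Derivation : Set (c Level.⊔ ℓ) where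
    field
      E : Carrier → Carrier
      E-cong : ∀ {x y} → x ≈ y → E x ≈ E y
      E-+ : ∀ x y → E (x + y) ≈ E x + E y
      E-* : ∀ x y → E (x * y) ≈ E x * y + x * E y

    x≈x+x⇒x≈0 : ∀ {x} → x ≈ x + x → x ≈ 0#
    x≈x+x⇒x≈0 {x} eq = begin
      x             ≈⟨ solve 1 (λ x → x := x :+ x :- x) refl x ⟩
      x + x - x     ≈⟨ +-congʳ eq ⟨
      x - x         ≈⟨ -‿inverseʳ x ⟩
      0#            ∎

    E-0 : E 0# ≈ 0#
    E-0 = x≈x+x⇒x≈0 (trans (E-cong (sym (+-identityʳ 0#))) (E-+ 0# 0#))

    E-1 : E 1# ≈ 0#
    E-1 = x≈x+x⇒x≈0 (trans (E-cong (sym (*-identityʳ 1#))) (trans (E-* 1# 1#) (+-cong (*-identityʳ _) (*-identityˡ _))))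

    E-neg : ∀ x → E (- x) ≈ - E x
    E-neg x = begin
      E (- x)                  ≈⟨ solve 2 (λ x y → y := (x :+ y) :- x) refl (E x) (E (- x)) ⟩
      (E x + E (- x)) - E x    ≈⟨ +-congʳ (trans (sym (E-+ x (- x))) (trans (E-cong (-‿inverseʳ x)) E-0)) ⟩
      0# - E x                 ≈⟨ +-identityˡ _ ⟩
      - E x                    ∎

    E-∑ : ∀ {n} (f : Vector Carrier n) → E (∑ f) ≈ ∑ (E ∘ f)
    E-∑ {zero}  f = trans (E-cong (∑-empty f)) (trans E-0 (sym (∑-empty _)))
    E-∑ {suc n} f = trans (E-cong (∑-suc f)) (trans (E-+ _ _) (trans (+-congˡ (E-∑ (f ∘ suc))) (sym (∑-suc _))))

    E-sign : ∀ j → E (sign j) ≈ 0#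
    E-sign zero    = E-1
    E-sign (suc j) = trans (E-neg _) (trans (-‿cong (E-sign j)) (trans (sym (+-identityˡ _)) (-‿inverseʳ 0#)))

    -- Leibniz rule along the first row: signs are constants, the derivative of an entry of row 0
    -- gives the summand for row 0, and the derivatives of the minors give the other summands by
    -- induction.
    E-det : ∀ n (M : Matrix n) → E (det n M) ≈ ∑ λ i → det n (M [ i ]≔ (E ∘ M i))
    E-det zero    M = trans E-1 (sym (∑-empty _))
    E-det (suc n) M = begin
      E (det (suc n) M)
        ≈⟨ E-∑ _ ⟩
      ∑ (λ j → E (sign (toℕ j) * M zero j * det n (minor j M)))
        ≈⟨ ∑-cong (λ j → trans (E-* _ _) (+-cong
             (*-congʳ (trans (E-* _ _) (trans (+-congʳ (trans (*-congʳ (E-sign (toℕ j))) (zeroˡ _))) (+-identityˡ _))))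
             (trans (*-congˡ (E-det n (minor j M))) (*-∑ _ _)))) ⟩
      ∑ (λ j → sign (toℕ j) * E (M zero j) * det n (minor j M)
               + ∑ (λ i → sign (toℕ j) * M zero j * det n (minor j M [ i ]≔ (E ∘ minor j M i))))
        ≈⟨ ∑-+ _ _ ⟩
      det (suc n) (M [ zero ]≔ (E ∘ M zero))
        + ∑ (λ j → ∑ (λ i → sign (toℕ j) * M zero j * det n (minor j M [ i ]≔ (E ∘ minor j M i))))
        ≈⟨ +-congˡ (trans (∑-swap _) (∑-cong λ i → ∑-cong λ j → *-congˡ (sym (det-minor-[]≔ M i (E ∘ M (suc i)) j)))) ⟩
      det (suc n) (M [ zero ]≔ (E ∘ M zero)) + ∑ (λ i → det (suc n) (M [ suc i ]≔ (E ∘ M (suc i))))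
        ≈⟨ ∑-suc _ ⟨
      ∑ (λ i → det (suc n) (M [ i ]≔ (E ∘ M i))) ∎

    -- By hypothesis row `i` of `c E(M)` is a combination of the rows of `M`. Put in place of row
    -- `i`, every row other than `M i` itself occurs twice and contributes nothing, so only the
    -- coefficient `B i i` survives. This form avoids both adjugate and inverse; `M` need not be
    -- invertible.
    jacobi : ∀ n (M B : Matrix n) c → (∀ i s → c * E (M i s) ≈ ∑ λ k → B i k * M k s) →
      c * E (det n M) ≈ ∑ (λ i → B i i) * det n M
    jacobi n M B c eq = begin
      c * E (det n M)                                                ≈⟨ *-congˡ (E-det n M) ⟩
      c * ∑ (λ i → det n (M [ i ]≔ (E ∘ M i)))                     ≈⟨ *-∑ _ _ ⟩
      ∑ (λ i → c * det n (M [ i ]≔ (E ∘ M i)))                     ≈⟨ ∑-cong row ⟩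
      ∑ (λ i → B i i * det n M)                                    ≈⟨ ∑-* _ _ ⟨
      ∑ (λ i → B i i) * det n M                                    ∎
      where
      row : ∀ i → c * det n (M [ i ]≔ (E ∘ M i)) ≈ B i i * det n M
      row i = begin
        c * det n (M [ i ]≔ (E ∘ M i))                      ≈⟨ det-scale M i c (E ∘ M i) ⟨
        det n (M [ i ]≔ (λ s → c * E (M i s)))              ≈⟨ det-cong n ([]≔-cong M i (eq i)) ⟩
        det n (M [ i ]≔ (λ s → ∑ λ k → B i k * M k s))    ≈⟨ det-linear M i (B i) M ⟩
        ∑ (λ k → B i k * det n (M [ i ]≔ M k))            ≈⟨ ∑-single i _ (λ k k≢i → trans (*-congˡ (repeated k k≢i)) (zeroʳ _)) ⟩
        B i i * det n (M [ i ]≔ M i)                        ≈⟨ *-congˡ (det-cong n (≗⇒≈ (updateAt-id-local i M ≡.refl))) ⟩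
        B i i * det n M                                     ∎
        where
        repeated : ∀ k → k ≢ i → det n (M [ i ]≔ M k) ≈ 0#
        repeated k k≢i = det-alternating n i k (k≢i ∘ ≡.sym) (M [ i ]≔ M k) λ s → reflexive (≡.cong (λ v → v s)
          (≡.trans (updateAt-updates i M) (≡.sym (updateAt-minimal k i M k≢i))))

-- Sums over an enumerated type

module EnumeratedSum {c ℓ} (S : CommutativeRing c ℓ) {a} {A : Set a} {m : ℕ} (enum : Fin m → A) where
  open CommutativeRing S hiding (zero)
  open FiniteSum S

  opaque
    Σₐ : (A → Carrier) → Carrier
    Σₐ f = ∑ (λ i → f (enum i))

    Σₐ-∑ : ∀ f → Σₐ f ≈ ∑ (λ i → f (enum i))
    Σₐ-∑ f = refl

    Σₐ-cong : ∀ {f g : A → Carrier} → (∀ a → f a ≈ g a) → Σₐ f ≈ Σₐ g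
    Σₐ-cong eq = ∑-cong (λ i → eq (enum i))

    Σₐ-+ : ∀ f g → Σₐ (λ a → f a + g a) ≈ Σₐ f + Σₐ g
    Σₐ-+ f g = ∑-+ _ _

    *-Σₐ : ∀ x f → x * Σₐ f ≈ Σₐ (λ a → x * f a)
    *-Σₐ x f = *-∑ x _

    Σₐ-* : ∀ x f → Σₐ f * x ≈ Σₐ (λ a → f a * x)
    Σₐ-* x f = ∑-* x _

    Σₐ-swap : ∀ (f : A → A → Carrier) → Σₐ (λ a → Σₐ (λ b → f a b)) ≈ Σₐ (λ b → Σₐ (λ a → f a b))
    Σₐ-swap f = ∑-swap _

    Σₐ-∑-swap : ∀ {n} (f : A → Fin n → Carrier) → Σₐ (λ a → ∑ (λ v → f a v)) ≈ ∑ (λ v → Σₐ (λ a → f a v))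
    Σₐ-∑-swap f = ∑-swap _

  Σₐ-- : ∀ f g → Σₐ (λ a → f a - g a) ≈ Σₐ f - Σₐ g
  Σₐ-- f g = trans (Σₐ-+ f (λ a → - g a)) (+-congˡ (begin
    Σₐ (λ a → - g a)          ≈⟨ Σₐ-cong (λ a → -1*x≈-x (g a)) ⟨
    Σₐ (λ a → - 1# * g a)     ≈⟨ *-Σₐ _ _ ⟨
    - 1# * Σₐ g               ≈⟨ -1*x≈-x _ ⟩
    - Σₐ g                    ∎))
    where
    open import Algebra.Properties.Ring ring using (-1*x≈-x)
    open import Relation.Binary.Reasoning.Setoid setoid

-- Woodbury's identity and the trace in Jacobi's formula

module Resolvent {c ℓ} (S : CommutativeRing c ℓ) {A : Set} {m : ℕ} (enum : Fin m → A) (n : ℕ) where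
  open CommutativeRing S hiding (zero)
  open FiniteSum S
  open EnumeratedSum S enum

  -- X plays the role of (I - tΘ)⁻¹ for Θ = PQ - J, where J is the permutation matrix of inv.
  record ResolventData : Set (c Level.⊔ ℓ) where
    field
      inv : A → A
      inv-involutive : ∀ a → inv (inv a) ≡ a
      Σₐ-inv : ∀ (f : A → Carrier) → Σₐ (λ a → f (inv a)) ≈ Σₐ f
      δₐ : A → A → Carrier
      δₐ-sum : ∀ a (f : A → Carrier) → Σₐ (λ b → δₐ a b * f b) ≈ f a
      δₐ-sym : ∀ a b → δₐ a b ≈ δₐ b a
      δₐ-inv : ∀ a → δₐ (inv a) a ≈ 0#
      δᵥ : Fin n → Fin n → Carrier
      δᵥ-sum : ∀ u (f : Fin n → Carrier) → ∑ (λ v → δᵥ u v * f v) ≈ f u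
      δᵥ-sym : ∀ u v → δᵥ u v ≈ δᵥ v u
      t s : Carrier
      s+t²≈1 : s + t * t ≈ 1#
      P : A → Fin n → Carrier
      Q : Fin n → A → Carrier
      X : A → A → Carrier
      resolventˡ : ∀ a b → X a b + t * X (inv a) b ≈ δₐ a b + t * Σₐ (λ c → ∑ (λ v → P a v * Q v c) * X c b)
      resolventʳ : ∀ a b → X a b + t * X a (inv b) ≈ δₐ a b + t * Σₐ (λ c → X a c * ∑ (λ v → P c v * Q v b))

  module Woodbury (𝓡 : ResolventData) where
    open ResolventData 𝓡
    open import Relation.Binary.Reasoning.Setoid setoid
    open IntegerCoefficientSolver S

    K : Fin n → A → Carrier
    K v b = Σₐ λ a → Q v a * X a b

    H : A → Fin n → Carrier
    H a v = Σₐ λ b → X a b * P b v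

    Y : Fin n → Fin n → Carrier
    Y u v = Σₐ λ a → Q u a * H a v

    -- In matrix terms `K = QX`, `H = XP` and `Y = QXP`, so this is `I + tQXP`, Woodbury's
    -- expression for the inverse of `I - tQ(I + tJ)⁻¹P`.
    W : Fin n → Fin n → Carrier
    W u v = δᵥ u v + t * Y u v

    Q[_] : (A → Fin n → Carrier) → Fin n → Fin n → Carrier
    Q[ F ] u v = Σₐ λ a → Q u a * F a v

    -- As a matrix this is the product `JP`: inversion permutes the rows of `P`. Hence `Q[ PJ ]` is
    -- `QJP`, the matrix that becomes `D`.
    PJ : A → Fin n → Carrier
    PJ a = P (inv a)

    -- `EM` is the entrywise Euler derivative of `M` for constant `P` and `Q`, with `E t = t` and
    -- `E s = -2t²`. It is written out because this module works over a ring without a derivation.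
    M EM : Fin n → Fin n → Carrier
    M u v = (s * δᵥ u v - t * Q[ P ] u v) + t * t * Q[ PJ ] u v
    EM u v = t * t * (Q[ PJ ] u v + Q[ PJ ] u v) - (t * Q[ P ] u v + t * t * (δᵥ u v + δᵥ u v))

    -- In matrix terms `resolventˡ` reads `(I + tJ)X = I + tPQX`; this solves it for `tPQX`. `HQ` is
    -- the mirror image from `resolventʳ`.
    PK : ∀ a b → t * ∑ (λ v → P a v * K v b) ≈ X a b + t * X (inv a) b - δₐ a b
    PK a b = begin
      t * ∑ (λ v → P a v * K v b)
        ≈⟨ *-congˡ (∑-cong λ v → trans (*-Σₐ _ _) (Σₐ-cong λ c → sym (*-assoc _ _ _))) ⟩
      t * ∑ (λ v → Σₐ λ c → P a v * Q v c * X c b)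
        ≈⟨ *-congˡ (trans (sym (Σₐ-∑-swap _)) (Σₐ-cong λ c → sym (∑-* _ _))) ⟩
      t * Σₐ (λ c → ∑ (λ v → P a v * Q v c) * X c b)
        ≈⟨ solve 2 (λ x d → x := d :+ x :- d) refl _ (δₐ a b) ⟩
      δₐ a b + t * Σₐ (λ c → ∑ (λ v → P a v * Q v c) * X c b) - δₐ a b
        ≈⟨ +-congʳ (resolventˡ a b) ⟨
      X a b + t * X (inv a) b - δₐ a b ∎

    HQ : ∀ a b → t * ∑ (λ v → H a v * Q v b) ≈ X a b + t * X a (inv b) - δₐ a b
    HQ a b = begin
      t * ∑ (λ v → H a v * Q v b)
        ≈⟨ *-congˡ (∑-cong λ v → trans (Σₐ-* _ _) (Σₐ-cong λ c → *-assoc _ _ _)) ⟩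
      t * ∑ (λ v → Σₐ λ c → X a c * (P c v * Q v b))
        ≈⟨ *-congˡ (trans (sym (Σₐ-∑-swap _)) (Σₐ-cong λ c → sym (*-∑ _ _))) ⟩
      t * Σₐ (λ c → X a c * ∑ (λ v → P c v * Q v b))
        ≈⟨ solve 2 (λ x d → x := d :+ x :- d) refl _ (δₐ a b) ⟩
      δₐ a b + t * Σₐ (λ c → X a c * ∑ (λ v → P c v * Q v b)) - δₐ a b
        ≈⟨ +-congʳ (resolventʳ a b) ⟨
      X a b + t * X a (inv b) - δₐ a b ∎

    -- Multiplying `HQ` by `Q` on the left gives `tQXPQ = Q(X + tXJ - I)`.
    YQ : ∀ u b → t * ∑ (λ v → Y u v * Q v b) ≈ K u b + t * K u (inv b) - Q u b
    YQ u b = begin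
      t * ∑ (λ v → Y u v * Q v b)
        ≈⟨ *-congˡ (∑-cong λ v → trans (Σₐ-* _ _) (Σₐ-cong λ a → *-assoc _ _ _)) ⟩
      t * ∑ (λ v → Σₐ λ a → Q u a * (H a v * Q v b))
        ≈⟨ *-congˡ (trans (sym (Σₐ-∑-swap _)) (Σₐ-cong λ c → sym (*-∑ _ _))) ⟩
      t * Σₐ (λ a → Q u a * ∑ (λ v → H a v * Q v b))
        ≈⟨ *-Σₐ _ _ ⟩
      Σₐ (λ a → t * (Q u a * ∑ (λ v → H a v * Q v b)))
        ≈⟨ Σₐ-cong (λ a → trans
             (solve 3 (λ t q h → t :* (q :* h) := q :* (t :* h)) refl t (Q u a) _)
             (trans (*-congˡ (HQ a b))
               (solve 5 (λ t q x x′ d → q :* (x :+ t :* x′ :- d) := (q :* x :+ t :* (q :* x′)) :- d :* q) refl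
                 t (Q u a) (X a b) (X a (inv b)) (δₐ a b)))) ⟩
      Σₐ (λ a → (Q u a * X a b + t * (Q u a * X a (inv b))) - δₐ a b * Q u a)
        ≈⟨ trans (Σₐ-- _ _) (+-cong (trans (Σₐ-+ _ _) (+-congˡ (sym (*-Σₐ _ _))))
             (-‿cong (trans (Σₐ-cong λ a → *-congʳ (δₐ-sym a b)) (δₐ-sum b (Q u))))) ⟩
      K u b + t * K u (inv b) - Q u b ∎

    KF : (A → Fin n → Carrier) → Fin n → Fin n → Carrier
    KF F u j = Σₐ λ b → K u b * F b j

    YQ[_] : ∀ F u j → t * ∑ (λ v → Y u v * Q[ F ] v j) ≈ KF F u j + t * KF (λ b → F (inv b)) u j - Q[ F ] u j
    YQ[ F ] u j = begin
      t * ∑ (λ v → Y u v * Q[ F ] v j)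
        ≈⟨ *-congˡ (trans (∑-cong λ v → trans (*-Σₐ _ _) (Σₐ-cong λ b → sym (*-assoc _ _ _)))
             (trans (sym (Σₐ-∑-swap _)) (Σₐ-cong λ b → sym (∑-* _ _)))) ⟩
      t * Σₐ (λ b → ∑ (λ v → Y u v * Q v b) * F b j)
        ≈⟨ trans (*-Σₐ _ _) (Σₐ-cong λ b → trans (sym (*-assoc _ _ _)) (*-congʳ (YQ u b))) ⟩
      Σₐ (λ b → (K u b + t * K u (inv b) - Q u b) * F b j)
        ≈⟨ Σₐ-cong (λ b → solve 5 (λ t k k′ q f → (k :+ t :* k′ :- q) :* f := (k :* f :+ t :* (k′ :* f)) :- q :* f) refl
             t (K u b) (K u (inv b)) (Q u b) (F b j)) ⟩
      Σₐ (λ b → (K u b * F b j + t * (K u (inv b) * F b j)) - Q u b * F b j)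
        ≈⟨ trans (Σₐ-- _ _) (+-congʳ (trans (Σₐ-+ _ _) (+-congˡ (sym (*-Σₐ _ _))))) ⟩
      KF F u j + t * Σₐ (λ b → K u (inv b) * F b j) - Q[ F ] u j
        -- Summing over `inv b` in place of `b` moves the inversion from `K` to `F`, that is,
        -- `(KJ)F = K(JF)`.
        ≈⟨ +-congʳ (+-congˡ (*-congˡ (trans
             (Σₐ-cong λ b → *-congˡ (reflexive (≡.cong (λ c → F c j) (≡.sym (inv-involutive b)))))
             (Σₐ-inv (λ b → K u b * F (inv b) j))))) ⟩
      KF F u j + t * KF (λ b → F (inv b)) u j - Q[ F ] u j ∎

    KP≈Y : ∀ u j → KF P u j ≈ Y u j
    KP≈Y u j = begin
      Σₐ (λ b → Σₐ (λ a → Q u a * X a b) * P b j)      ≈⟨ Σₐ-cong (λ b → trans (Σₐ-* _ _) (Σₐ-cong λ a → *-assoc _ _ _)) ⟩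
      Σₐ (λ b → Σₐ (λ a → Q u a * (X a b * P b j)))    ≈⟨ Σₐ-swap _ ⟩
      Σₐ (λ a → Σₐ (λ b → Q u a * (X a b * P b j)))    ≈⟨ Σₐ-cong (λ a → sym (*-Σₐ _ _)) ⟩
      Y u j                                            ∎

    ∑δᵥʳ : ∀ (f : Fin n → Carrier) j → ∑ (λ v → f v * δᵥ v j) ≈ f j
    ∑δᵥʳ f j = trans (∑-cong λ v → trans (*-comm _ _) (*-congʳ (δᵥ-sym v j))) (δᵥ-sum j f)

    ∑-affine : ∀ (f g h : Fin n → Carrier) x y z →
      ∑ (λ v → x * f v + y * g v + z * h v) ≈ x * ∑ f + y * ∑ g + z * ∑ h
    ∑-affine f g h x y z = trans (∑-+ _ _) (+-cong (trans (∑-+ _ _) (+-cong (sym (*-∑ _ _)) (sym (*-∑ _ _)))) (sym (*-∑ _ _)))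

    -- `YQ[_]` evaluates `tY` against `QP` and against `QJP`. The terms in `QXJP` cancel, `J² = I`
    -- turns `QXJJP` back into `Y`, and what is left of `Y` has the coefficient `t(s + t² - 1) = 0`.
    WM≈s : ∀ u j → ∑ (λ v → W u v * M v j) ≈ s * δᵥ u j
    WM≈s u j = begin
      ∑ (λ v → W u v * M v j)
        ≈⟨ ∑-cong (λ v → distribʳ _ _ _) ⟩
      ∑ (λ v → δᵥ u v * M v j + t * Y u v * M v j)
        ≈⟨ ∑-+ _ _ ⟩
      ∑ (λ v → δᵥ u v * M v j) + ∑ (λ v → t * Y u v * M v j)
        ≈⟨ +-cong (δᵥ-sum u (λ v → M v j)) YM ⟩
      M u j + (t * s * Y u j + (- (t * (Y u j + t * κ - q)) + t * t * (κ + t * Y u j - q′)))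
        ≈⟨ solve 7 (λ s t d y k q q′ →
             (s :* d :- t :* q) :+ t :* t :* q′ :+ (t :* s :* y :+ (:- (t :* (y :+ t :* k :- q)) :+ t :* t :* (k :+ t :* y :- q′)))
             := s :* d :+ t :* ((s :+ t :* t) :* y :- y)) refl s t (δᵥ u j) (Y u j) κ q q′ ⟩
      s * δᵥ u j + t * ((s + t * t) * Y u j - Y u j)
        ≈⟨ +-congˡ (trans (*-congˡ (trans (+-congʳ (trans (*-congʳ (s+t²≈1)) (*-identityˡ _))) (-‿inverseʳ _))) (zeroʳ _)) ⟩
      s * δᵥ u j + 0#
        ≈⟨ +-identityʳ _ ⟩
      s * δᵥ u j ∎
      where
      κ = KF PJ u j
      q = Q[ P ] u j
      q′ = Q[ PJ ] u j
      KPJJ≈Y : KF (λ b → PJ (inv b)) u j ≈ Y u j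
      KPJJ≈Y = trans (Σₐ-cong λ b → *-congˡ (reflexive (≡.cong (λ c → P c j) (inv-involutive b)))) (KP≈Y u j)
      YM : ∑ (λ v → t * Y u v * M v j) ≈ t * s * Y u j + (- (t * (Y u j + t * κ - q)) + t * t * (κ + t * Y u j - q′))
      YM = begin
        ∑ (λ v → t * Y u v * M v j)
          ≈⟨ ∑-cong (λ v → solve 6 (λ s t y d q q′ →
               t :* y :* ((s :* d :- t :* q) :+ t :* t :* q′) := t :* s :* (y :* d) :+ :- (t :* t) :* (y :* q) :+ t :* t :* t :* (y :* q′))
               refl s t (Y u v) (δᵥ v j) (Q[ P ] v j) (Q[ PJ ] v j)) ⟩
        ∑ (λ v → t * s * (Y u v * δᵥ v j) + - (t * t) * (Y u v * Q[ P ] v j) + t * t * t * (Y u v * Q[ PJ ] v j))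
          ≈⟨ ∑-affine _ _ _ _ _ _ ⟩
        t * s * ∑ (λ v → Y u v * δᵥ v j) + - (t * t) * ∑ (λ v → Y u v * Q[ P ] v j) + t * t * t * ∑ (λ v → Y u v * Q[ PJ ] v j)
          ≈⟨ solve 5 (λ s t a b c → t :* s :* a :+ :- (t :* t) :* b :+ t :* t :* t :* c
               := t :* s :* a :+ (:- (t :* (t :* b)) :+ t :* t :* (t :* c))) refl s t _ _ _ ⟩
        t * s * ∑ (λ v → Y u v * δᵥ v j) + (- (t * (t * ∑ (λ v → Y u v * Q[ P ] v j))) + t * t * (t * ∑ (λ v → Y u v * Q[ PJ ] v j)))
          ≈⟨ +-cong (*-congˡ (∑δᵥʳ (Y u) j)) (+-cong
               (-‿cong (*-congˡ (trans (YQ[ P ] u j) (+-congʳ (+-congʳ (KP≈Y u j))))))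
               (*-congˡ (trans (YQ[ PJ ] u j) (+-congʳ (+-congˡ (*-congˡ KPJJ≈Y)))))) ⟩
        t * s * Y u j + (- (t * (Y u j + t * κ - q)) + t * t * (κ + t * Y u j - q′)) ∎

    EMW : Fin n → Fin n → Carrier
    EMW u v = ∑ λ k → EM u k * W k v

    -- Associativity moves `W` next to `M`, where `WM = sI`. This is the hypothesis of `jacobi` for
    -- `c = s` and `B = EMW`.
    s*EM : ∀ u j → s * EM u j ≈ ∑ (λ v → EMW u v * M v j)
    s*EM u j = sym (begin
      ∑ (λ v → EMW u v * M v j)                            ≈⟨ ∑-cong (λ v → trans (∑-* _ _) (∑-cong λ k → *-assoc _ _ _)) ⟩
      ∑ (λ v → ∑ (λ k → EM u k * (W k v * M v j)))         ≈⟨ ∑-swap _ ⟩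
      ∑ (λ k → ∑ (λ v → EM u k * (W k v * M v j)))         ≈⟨ ∑-cong (λ k → trans (sym (*-∑ _ _)) (*-congˡ (WM≈s k j))) ⟩
      ∑ (λ k → EM u k * (s * δᵥ k j))                      ≈⟨ ∑-cong (λ k → solve 3 (λ e s d → e :* (s :* d) := (s :* e) :* d) refl (EM u k) s (δᵥ k j)) ⟩
      ∑ (λ k → s * EM u k * δᵥ k j)                        ≈⟨ ∑δᵥʳ (λ k → s * EM u k) j ⟩
      s * EM u j                                           ∎)

    trX trJX trδₐ trδᵥ : Carrier
    trX = Σₐ λ a → X a a
    trJX = Σₐ λ a → X (inv a) a
    trδₐ = Σₐ λ a → δₐ a a
    trδᵥ = ∑ λ v → δᵥ v v

    -- The trace of `FK` when `π` is the identity, and of `FKJ` when `π` is inversion.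
    FK : (A → Fin n → Carrier) → (A → A) → Carrier
    FK F π = Σₐ λ a → ∑ λ v → F a v * K v (π a)

    -- Cyclicity of the trace brings `W` next to `Q`, and `WQ = Q + tYQ = K + tKJ` by `YQ`. So a
    -- trace over vertices becomes a trace over arcs, to which the resolvent equations apply.
    trQW : ∀ F → ∑ (λ u → ∑ λ v → Q[ F ] u v * W v u) ≈ FK F (λ a → a) + t * FK F inv
    trQW F = begin
      ∑ (λ u → ∑ λ v → Q[ F ] u v * W v u)
        ≈⟨ ∑-swap _ ⟩
      ∑ (λ v → ∑ λ u → Q[ F ] u v * W v u)
        ≈⟨ ∑-cong (λ v → trans (∑-cong λ u → Σₐ-* _ _) (sym (Σₐ-∑-swap _))) ⟩
      ∑ (λ v → Σₐ λ a → ∑ λ u → Q u a * F a v * W v u)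
        ≈⟨ sym (Σₐ-∑-swap _) ⟩
      Σₐ (λ a → ∑ λ v → ∑ λ u → Q u a * F a v * W v u)
        ≈⟨ Σₐ-cong (λ a → ∑-cong λ v → trans
             (∑-cong λ u → solve 5 (λ q f d t y → q :* f :* (d :+ t :* y) := f :* (d :* q :+ t :* (y :* q))) refl (Q u a) (F a v) (δᵥ v u) t (Y v u))
             (trans (sym (*-∑ _ _)) (*-congˡ (QW v a)))) ⟩
      Σₐ (λ a → ∑ λ v → F a v * (K v a + t * K v (inv a)))
        ≈⟨ Σₐ-cong (λ a → trans
             (∑-cong λ v → solve 4 (λ f k t k′ → f :* (k :+ t :* k′) := f :* k :+ t :* (f :* k′)) refl (F a v) (K v a) t (K v (inv a)))
             (trans (∑-+ _ _) (+-congˡ (sym (*-∑ _ _))))) ⟩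
      Σₐ (λ a → ∑ (λ v → F a v * K v a) + t * ∑ (λ v → F a v * K v (inv a)))
        ≈⟨ trans (Σₐ-+ _ _) (+-congˡ (sym (*-Σₐ _ _))) ⟩
      FK F (λ a → a) + t * FK F inv ∎
      where
      QW : ∀ v a → ∑ (λ u → δᵥ v u * Q u a + t * (Y v u * Q u a)) ≈ K v a + t * K v (inv a)
      QW v a = begin
        ∑ (λ u → δᵥ v u * Q u a + t * (Y v u * Q u a))         ≈⟨ trans (∑-+ _ _) (+-cong (δᵥ-sum v (λ u → Q u a)) (sym (*-∑ _ _))) ⟩
        Q v a + t * ∑ (λ u → Y v u * Q u a)                    ≈⟨ +-congˡ (YQ v a) ⟩
        Q v a + (K v a + t * K v (inv a) - Q v a)              ≈⟨ solve 2 (λ q k → q :+ (k :- q) := k) refl (Q v a) _ ⟩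
        K v a + t * K v (inv a)                                ∎

    tPK : t * FK P (λ a → a) ≈ trX + t * trJX - trδₐ
    tPK = begin
      t * FK P (λ a → a)                                    ≈⟨ trans (*-Σₐ _ _) (Σₐ-cong λ a → PK a a) ⟩
      Σₐ (λ a → X a a + t * X (inv a) a - δₐ a a)           ≈⟨ trans (Σₐ-- _ _) (+-congʳ (trans (Σₐ-+ _ _) (+-congˡ (sym (*-Σₐ _ _))))) ⟩
      trX + t * trJX - trδₐ                                 ∎

    tPJK : t * FK PJ (λ a → a) ≈ trJX + t * trX
    tPJK = begin
      t * FK PJ (λ a → a)                                          ≈⟨ trans (*-Σₐ _ _) (Σₐ-cong λ a → PK (inv a) a) ⟩
      Σₐ (λ a → X (inv a) a + t * X (inv (inv a)) a - δₐ (inv a) a)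
        -- Inversion fixes no arc, so the identity matrix contributes nothing to this trace.
        ≈⟨ Σₐ-cong (λ a → trans (+-cong (+-congˡ (*-congˡ (reflexive (≡.cong (λ c → X c a) (inv-involutive a))))) (trans (-‿cong (δₐ-inv a)) -0#≈0#)) (+-identityʳ _)) ⟩
      Σₐ (λ a → X (inv a) a + t * X a a)                           ≈⟨ trans (Σₐ-+ _ _) (+-congˡ (sym (*-Σₐ _ _))) ⟩
      trJX + t * trX                                               ∎
      where open import Algebra.Properties.Ring ring using (-0#≈0#)

    FK-inv : ∀ F → FK (λ a → F (inv a)) inv ≈ FK F (λ a → a)
    FK-inv F = Σₐ-inv (λ a → ∑ λ v → F a v * K v a)

    PKinv : FK P inv ≈ FK PJ (λ a → a)
    PKinv = trans (Σₐ-cong λ a → ∑-cong λ v → *-congʳ (reflexive (≡.cong (λ c → P c v) (≡.sym (inv-involutive a))))) (FK-inv PJ)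

    trY : ∑ (λ v → Y v v) ≈ FK P (λ a → a)
    trY = trans (∑-cong λ v → sym (KP≈Y v v))
      (trans (sym (Σₐ-∑-swap _)) (Σₐ-cong λ a → ∑-cong λ v → *-comm _ _))

    trW : ∑ (λ v → W v v) ≈ trδᵥ + t * FK P (λ a → a)
    trW = trans (∑-+ _ _) (+-congˡ (trans (sym (*-∑ _ _)) (*-congˡ trY)))

    -- All three traces in `EMW` reduce to those of `PK` and `JPK`, hence to `trX` and `trJX`. The
    -- `trJX` terms cancel, and `trX` is left with the coefficient `t² - 1 = -s`. With `trδₐ` and
    -- `trδᵥ` counting arcs and vertices, this is where 2|E| and 2t²|V| arise.
    trEMW : ∑ (λ u → EMW u u) + s * trX + t * t * (trδᵥ + trδᵥ) ≈ trδₐ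
    trEMW = begin
      ∑ (λ u → EMW u u) + s * trX + t * t * (trδᵥ + trδᵥ)
        ≈⟨ +-congʳ (+-congʳ expand) ⟩
      (t * t + t * t) * (FK PJ idₐ + t * FK PJ inv) + - t * (FK P idₐ + t * FK P inv) + - (t * t + t * t) * (trδᵥ + t * FK P idₐ)
        + s * trX + t * t * (trδᵥ + trδᵥ)
        ≈⟨ +-congʳ (+-congʳ (+-congʳ (+-cong (*-congˡ (+-congˡ (*-congˡ (FK-inv P)))) (*-congˡ (+-congˡ (*-congˡ PKinv)))))) ⟩
      (t * t + t * t) * (FK PJ idₐ + t * FK P idₐ) + - t * (FK P idₐ + t * FK PJ idₐ) + - (t * t + t * t) * (trδᵥ + t * FK P idₐ)
        + s * trX + t * t * (trδᵥ + trδᵥ)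
        ≈⟨ solve 6 (λ t s z y x d →
             (t :* t :+ t :* t) :* (z :+ t :* y) :+ :- t :* (y :+ t :* z) :+ :- (t :* t :+ t :* t) :* (d :+ t :* y)
               :+ s :* x :+ t :* t :* (d :+ d)
             := t :* (t :* z) :- t :* y :+ s :* x) refl t s (FK PJ idₐ) (FK P idₐ) trX trδᵥ ⟩
      t * (t * FK PJ idₐ) - t * FK P idₐ + s * trX
        ≈⟨ +-congʳ (+-cong (*-congˡ tPJK) (-‿cong tPK)) ⟩
      t * (trJX + t * trX) - (trX + t * trJX - trδₐ) + s * trX
        ≈⟨ solve 5 (λ t s j x d → t :* (j :+ t :* x) :- (x :+ t :* j :- d) :+ s :* x
             := ((s :+ t :* t) :* x :- x) :+ d) refl t s trJX trX trδₐ ⟩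
      ((s + t * t) * trX - trX) + trδₐ
        ≈⟨ +-congʳ (trans (+-congʳ (trans (*-congʳ (s+t²≈1)) (*-identityˡ _))) (-‿inverseʳ _)) ⟩
      0# + trδₐ
        ≈⟨ +-identityˡ _ ⟩
      trδₐ ∎
      where
      idₐ : A → A
      idₐ a = a
      expand : ∑ (λ u → EMW u u) ≈ (t * t + t * t) * (FK PJ idₐ + t * FK PJ inv) + - t * (FK P idₐ + t * FK P inv)
        + - (t * t + t * t) * (trδᵥ + t * FK P idₐ)
      expand = begin
        ∑ (λ u → ∑ λ v → EM u v * W v u)
          ≈⟨ ∑-cong (λ u → trans
               (∑-cong λ v → solve 5 (λ t a b d w → (t :* t :* (b :+ b) :- (t :* a :+ t :* t :* (d :+ d))) :* w
                 := (t :* t :+ t :* t) :* (b :* w) :+ :- t :* (a :* w) :+ :- (t :* t :+ t :* t) :* (d :* w)) refl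
                 t (Q[ P ] u v) (Q[ PJ ] u v) (δᵥ u v) (W v u))
               (trans (∑-affine _ _ _ _ _ _) (+-congˡ (*-congˡ (δᵥ-sum u (λ v → W v u)))))) ⟩
        ∑ (λ u → (t * t + t * t) * ∑ (λ v → Q[ PJ ] u v * W v u) + - t * ∑ (λ v → Q[ P ] u v * W v u) + - (t * t + t * t) * W u u)
          ≈⟨ ∑-affine _ _ _ _ _ _ ⟩
        (t * t + t * t) * ∑ (λ u → ∑ (λ v → Q[ PJ ] u v * W v u)) + - t * ∑ (λ u → ∑ (λ v → Q[ P ] u v * W v u))
          + - (t * t + t * t) * ∑ (λ u → W u u)
          ≈⟨ +-cong (+-cong (*-congˡ (trQW PJ)) (*-congˡ (trQW P))) (*-congˡ trW) ⟩
        (t * t + t * t) * (FK PJ idₐ + t * FK PJ inv) + - t * (FK P idₐ + t * FK P inv)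
          + - (t * t + t * t) * (trδᵥ + t * FK P idₐ) ∎

-- Formal power series as a commutative ring

module RingIdentities {c ℓ} (S : CommutativeRing c ℓ) where
  open CommutativeRing S
  open IntegerCoefficientSolver S

  -- The inductive step of the rule for the derivative of a power: `d` is the derivative of `f`, `g`
  -- is a power of `f`, and `k` is the exponent of `f * g`.
  power-rule : ∀ k d f g → d * (f * g) + f * (k * (d * g)) ≈ (1# + k) * (d * (f * g))
  power-rule k d f g = trans (+-congʳ (sym (*-identityˡ _)))
    (solve 5 (λ e k d f g → e :* (d :* (f :* g)) :+ f :* (k :* (d :* g)) := (e :+ k) :* (d :* (f :* g))) refl 1# k d f g)

  rotate : ∀ x y z w → x * (y * (z * w)) ≈ z * ((x * y) * w)
  rotate = solve 4 (λ x y z w → x :* (y :* (z :* w)) := z :* ((x :* y) :* w)) refl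

module PowerSeries {c ℓ} (R : CommutativeRing c ℓ) (inv : ℕ → CommutativeRing.Carrier R) where
  open CommutativeRing R hiding (zero)
  open Zeta R inv
  open import Relation.Binary.Reasoning.Setoid setoid
  open IntegerCoefficientSolver R

  -- A record, so that the two series can be inferred from a proof of their equality.
  record _≋_ (f g : PS) : Set ℓ where
    constructor coefficientwise
    field at : f ≈ₚ g
  open _≋_ public

  -- By computation, `(f *ₚ g) (suc n)` is `f 0 * g (suc n) + (tail f *ₚ g) n`. The inductions on
  -- the coefficient below rest on this unfolding.
  tail : PS → PS
  tail f n = f (suc n)

  *ₚ-zero : ∀ f g → (f *ₚ g) 0 ≈ f 0 * g 0
  *ₚ-zero f g = +-identityʳ _

  *ₚ-cong-≤ : ∀ n {f f′ g g′} → f ≈ₚ f′ → (∀ m → m ≤ n → g m ≈ g′ m) → (f *ₚ g) n ≈ (f′ *ₚ g′) n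
  *ₚ-cong-≤ zero    f≈f′ g≈g′ = +-congʳ (*-cong (f≈f′ 0) (g≈g′ 0 z≤n))
  *ₚ-cong-≤ (suc n) f≈f′ g≈g′ = +-cong (*-cong (f≈f′ 0) (g≈g′ (suc n) ℕ.≤-refl))
    (*ₚ-cong-≤ n (f≈f′ ∘ suc) λ m m≤n → g≈g′ m (ℕ.m≤n⇒m≤1+n m≤n))

  *ₚ-cong : ∀ {f f′ g g′} → f ≈ₚ f′ → g ≈ₚ g′ → f *ₚ g ≈ₚ f′ *ₚ g′
  *ₚ-cong f≈f′ g≈g′ n = *ₚ-cong-≤ n f≈f′ λ m _ → g≈g′ m

  *ₚ-distribʳ : ∀ h f g → (f +ₚ g) *ₚ h ≈ₚ (f *ₚ h) +ₚ (g *ₚ h)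
  *ₚ-distribʳ h f g zero = begin
    ((f +ₚ g) *ₚ h) 0                  ≈⟨ *ₚ-zero (f +ₚ g) h ⟩
    (f 0 + g 0) * h 0                  ≈⟨ distribʳ _ _ _ ⟩
    f 0 * h 0 + g 0 * h 0              ≈⟨ +-cong (*ₚ-zero f h) (*ₚ-zero g h) ⟨
    (f *ₚ h) 0 + (g *ₚ h) 0            ∎
  *ₚ-distribʳ h f g (suc n) = begin
    (f 0 + g 0) * h (suc n) + ((tail f +ₚ tail g) *ₚ h) n
      ≈⟨ +-congˡ (*ₚ-distribʳ h (tail f) (tail g) n) ⟩
    (f 0 + g 0) * h (suc n) + ((tail f *ₚ h) n + (tail g *ₚ h) n)
      ≈⟨ solve 5 (λ a b c x y → (a :+ b) :* c :+ (x :+ y) := (a :* c :+ x) :+ (b :* c :+ y)) refl (f 0) (g 0) (h (suc n)) _ _ ⟩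
    (f *ₚ h) (suc n) + (g *ₚ h) (suc n) ∎

  -- Products compute by shifting the left factor; this mirror form, which shifts the right factor,
  -- is what commutativity compares it with.
  *ₚ-suc′ : ∀ f g n → (f *ₚ g) (suc n) ≈ (f *ₚ tail g) n + f (suc n) * g 0
  *ₚ-suc′ f g zero = begin
    f 0 * g 1 + (tail f *ₚ g) 0           ≈⟨ +-cong (sym (+-identityʳ _)) (*ₚ-zero (tail f) g) ⟩
    (f *ₚ tail g) 0 + f 1 * g 0           ∎
  *ₚ-suc′ f g (suc n) = begin
    f 0 * g (suc (suc n)) + (tail f *ₚ g) (suc n)
      ≈⟨ +-congˡ (*ₚ-suc′ (tail f) g n) ⟩
    f 0 * g (suc (suc n)) + ((tail f *ₚ tail g) n + f (suc (suc n)) * g 0)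
      ≈⟨ +-assoc _ _ _ ⟨
    (f *ₚ tail g) (suc n) + f (suc (suc n)) * g 0 ∎

  *ₚ-comm : ∀ f g → f *ₚ g ≈ₚ g *ₚ f
  *ₚ-comm f g zero    = +-congʳ (*-comm _ _)
  *ₚ-comm f g (suc n) = begin
    f 0 * g (suc n) + (tail f *ₚ g) n       ≈⟨ +-cong (*-comm _ _) (*ₚ-comm (tail f) g n) ⟩
    g (suc n) * f 0 + (g *ₚ tail f) n       ≈⟨ +-comm _ _ ⟩
    (g *ₚ tail f) n + g (suc n) * f 0       ≈⟨ *ₚ-suc′ g f n ⟨
    (g *ₚ f) (suc n)                        ∎

  scale : Carrier → PS → PS
  scale x f n = x * f n

  scale-*ₚ : ∀ x f g → scale x f *ₚ g ≈ₚ scale x (f *ₚ g)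
  scale-*ₚ x f g zero    = trans (*ₚ-zero (scale x f) g) (trans (*-assoc _ _ _) (*-congˡ (sym (*ₚ-zero f g))))
  scale-*ₚ x f g (suc n) = begin
    x * f 0 * g (suc n) + (scale x (tail f) *ₚ g) n    ≈⟨ +-cong (*-assoc _ _ _) (scale-*ₚ x (tail f) g n) ⟩
    x * (f 0 * g (suc n)) + x * (tail f *ₚ g) n        ≈⟨ distribˡ _ _ _ ⟨
    x * (f *ₚ g) (suc n)                               ∎

  *ₚ-assoc : ∀ f g h → (f *ₚ g) *ₚ h ≈ₚ f *ₚ (g *ₚ h)
  *ₚ-assoc f g h zero = begin
    ((f *ₚ g) *ₚ h) 0       ≈⟨ trans (*ₚ-zero (f *ₚ g) h) (*-congʳ (*ₚ-zero f g)) ⟩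
    f 0 * g 0 * h 0         ≈⟨ *-assoc _ _ _ ⟩
    f 0 * (g 0 * h 0)       ≈⟨ trans (*ₚ-zero f (g *ₚ h)) (*-congˡ (*ₚ-zero g h)) ⟨
    (f *ₚ (g *ₚ h)) 0       ∎
  *ₚ-assoc f g h (suc n) = begin
    (f *ₚ g) 0 * h (suc n) + (tail (f *ₚ g) *ₚ h) n
      -- `tail (f *ₚ g)` computes to `scale (f 0) (tail g) +ₚ (tail f *ₚ g)`.
      ≈⟨ +-cong (*-congʳ (*ₚ-zero f g)) (*ₚ-distribʳ h (scale (f 0) (tail g)) (tail f *ₚ g) n) ⟩
    f 0 * g 0 * h (suc n) + ((scale (f 0) (tail g) *ₚ h) n + ((tail f *ₚ g) *ₚ h) n)
      ≈⟨ +-congˡ (+-cong (scale-*ₚ (f 0) (tail g) h n) (*ₚ-assoc (tail f) g h n)) ⟩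
    f 0 * g 0 * h (suc n) + (f 0 * (tail g *ₚ h) n + (tail f *ₚ (g *ₚ h)) n)
      ≈⟨ solve 5 (λ a b c x y → a :* b :* c :+ (a :* x :+ y) := a :* (b :* c :+ x) :+ y) refl (f 0) (g 0) (h (suc n)) _ _ ⟩
    (f *ₚ (g *ₚ h)) (suc n) ∎

  *ₚ-zeroˡ : ∀ f g → (∀ n → f n ≈ 0#) → ∀ n → (f *ₚ g) n ≈ 0#
  *ₚ-zeroˡ f g f≈0 zero    = trans (*ₚ-zero f g) (trans (*-congʳ (f≈0 0)) (zeroˡ _))
  *ₚ-zeroˡ f g f≈0 (suc n) = trans (+-cong (trans (*-congʳ (f≈0 0)) (zeroˡ _)) (*ₚ-zeroˡ (tail f) g (f≈0 ∘ suc) n)) (+-identityʳ _)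

  *ₚ-vanish : ∀ n f g → (∀ m → m ≤ n → g m ≈ 0#) → (f *ₚ g) n ≈ 0#
  *ₚ-vanish n f g g≈0 = trans (*ₚ-cong-≤ n {f} (λ _ → refl) g≈0)
    (trans (*ₚ-comm f (λ _ → 0#) n) (*ₚ-zeroˡ (λ _ → 0#) f (λ _ → refl) n))

  constP-*ₚ : ∀ x g n → (constP x *ₚ g) n ≈ x * g n
  constP-*ₚ x g zero    = *ₚ-zero (constP x) g
  constP-*ₚ x g (suc n) = trans (+-congˡ (*ₚ-zeroˡ _ g (λ _ → refl) n)) (+-identityʳ _)

  tP-*ₚ-zero : ∀ g → (tP *ₚ g) 0 ≈ 0#
  tP-*ₚ-zero g = trans (*ₚ-zero tP g) (zeroˡ _)

  tP-*ₚ-suc : ∀ g n → (tP *ₚ g) (suc n) ≈ g n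
  tP-*ₚ-suc g n = begin
    0# * g (suc n) + (tail tP *ₚ g) n       ≈⟨ +-cong (zeroˡ _) (*ₚ-cong {g = g} tail-tP (λ _ → refl) n) ⟩
    0# + (constP 1# *ₚ g) n                 ≈⟨ trans (+-identityˡ _) (constP-*ₚ 1# g n) ⟩
    1# * g n                                ≈⟨ *-identityˡ _ ⟩
    g n                                     ∎
    where
    tail-tP : tail tP ≈ₚ constP 1#
    tail-tP zero    = refl
    tail-tP (suc n) = refl

  constP-0 : ∀ n → constP 0# n ≈ 0#
  constP-0 zero    = refl
  constP-0 (suc n) = refl

  powerSeriesRing : CommutativeRing c ℓ
  powerSeriesRing = record
    { Carrier = PS
    ; _≈_ = _≋_
    ; _+_ = _+ₚ_
    ; _*_ = _*ₚ_
    ; -_ = -ₚ_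
    ; 0# = constP 0#
    ; 1# = constP 1#
    ; isCommutativeRing = record
      { isRing = record
        { +-isAbelianGroup = record
          { isGroup = record
            { isMonoid = record
              { isSemigroup = record
                { isMagma = record
                  { isEquivalence = record
                    { refl = coefficientwise λ n → refl
                    ; sym = λ p → coefficientwise λ n → sym (at p n)
                    ; trans = λ p q → coefficientwise λ n → trans (at p n) (at q n)
                    }
                  ; ∙-cong = λ p q → coefficientwise λ n → +-cong (at p n) (at q n)
                  }
                ; assoc = λ f g h → coefficientwise λ n → +-assoc _ _ _
                }
              ; identity = (λ f → coefficientwise (0+ f)) , λ f → coefficientwise λ n → trans (+-comm _ _) (0+ f n)
              }
            ; inverse = (λ f → coefficientwise λ n → trans (-‿inverseˡ (f n)) (sym (constP-0 n)))
                      , (λ f → coefficientwise λ n → trans (-‿inverseʳ (f n)) (sym (constP-0 n)))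
            ; ⁻¹-cong = λ p → coefficientwise λ n → -‿cong (at p n)
            }
          ; comm = λ f g → coefficientwise λ n → +-comm _ _
          }
        ; *-cong = λ p q → coefficientwise (*ₚ-cong (at p) (at q))
        ; *-assoc = λ f g h → coefficientwise (*ₚ-assoc f g h)
        ; *-identity = (λ f → coefficientwise (1* f)) , λ f → coefficientwise λ n → trans (*ₚ-comm f (constP 1#) n) (1* f n)
        ; distrib = (λ f g h → coefficientwise λ n →
              trans (*ₚ-comm f (g +ₚ h) n) (trans (*ₚ-distribʳ f g h n) (+-cong (*ₚ-comm g f n) (*ₚ-comm h f n))))
            , (λ f g h → coefficientwise (*ₚ-distribʳ f g h))
        }
      ; *-comm = λ f g → coefficientwise (*ₚ-comm f g)
      }
    }
    where
    0+ : ∀ f n → constP 0# n + f n ≈ f n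
    0+ f n = trans (+-congʳ (constP-0 n)) (+-identityˡ _)
    1* : ∀ f → constP 1# *ₚ f ≈ₚ f
    1* f n = trans (constP-*ₚ 1# f n) (*-identityˡ _)

  module 𝕊 = CommutativeRing powerSeriesRing

  -- The fixed factor cannot be inferred, since a product of series unfolds under η.
  *ₚ-congˡ : ∀ f {g h} → g ≋ h → (f *ₚ g) ≋ (f *ₚ h)
  *ₚ-congˡ f = 𝕊.*-congˡ {f}

  *ₚ-congʳ : ∀ f {g h} → g ≋ h → (g *ₚ f) ≋ (h *ₚ f)
  *ₚ-congʳ f = 𝕊.*-congʳ {f}

  constP-cong : ∀ {x y} → x ≈ y → constP x ≋ constP y
  constP-cong eq = coefficientwise λ { zero → eq ; (suc n) → refl }

  constP-+ : ∀ x y → constP (x + y) ≋ (constP x +ₚ constP y)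
  constP-+ x y = coefficientwise λ { zero → refl ; (suc n) → sym (+-identityʳ _) }

  constP-neg : ∀ x → constP (- x) ≋ (-ₚ constP x)
  constP-neg x = coefficientwise λ { zero → refl ; (suc n) → sym -0#≈0# }
    where open import Algebra.Properties.Ring ring using (-0#≈0#)

  constP-* : ∀ x y → constP (x * y) ≋ (constP x *ₚ constP y)
  constP-* x y = coefficientwise λ
    { zero → sym (constP-*ₚ x (constP y) zero)
    ; (suc n) → sym (trans (constP-*ₚ x (constP y) (suc n)) (zeroʳ _)) }

  module ∑ᴿ = FiniteSum R
  module ∑ᴾ = FiniteSum powerSeriesRing

  ∑-coefficient : ∀ {m} (f : Fin m → PS) n → ∑ᴾ.∑ f n ≈ ∑ᴿ.∑ (λ i → f i n)
  ∑-coefficient {zero}  f n = trans (at (∑ᴾ.∑-empty f) n) (trans (constP-0 n) (sym (∑ᴿ.∑-empty _)))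
  ∑-coefficient {suc m} f n = trans (at (∑ᴾ.∑-suc f) n) (trans (+-congˡ (∑-coefficient (f ∘ suc) n)) (sym (∑ᴿ.∑-suc _)))

  constP-∑ : ∀ {m} (f : Fin m → Carrier) → constP (∑ᴿ.∑ f) ≋ ∑ᴾ.∑ (λ i → constP (f i))
  constP-∑ {m} f = coefficientwise λ
    { zero → sym (∑-coefficient (λ i → constP (f i)) 0)
    ; (suc n) → sym (trans (∑-coefficient (λ i → constP (f i)) (suc n)) (∑ᴿ.∑-zero _ λ i → refl)) }

  module Detᴾ = Determinant powerSeriesRing

  sign-sgn : ∀ j → constP (sgn j) ≋ Detᴾ.sign j
  sign-sgn zero    = 𝕊.refl
  sign-sgn (suc j) = 𝕊.trans (constP-neg _) (𝕊.-‿cong (sign-sgn j))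

  sumFP-∑ : ∀ n (f : Fin n → PS) → sumFP n f ≋ ∑ᴾ.∑ f
  sumFP-∑ zero    f = 𝕊.sym (∑ᴾ.∑-empty f)
  sumFP-∑ (suc n) f = 𝕊.trans (𝕊.+-congˡ (sumFP-∑ n (f ∘ suc))) (𝕊.sym (∑ᴾ.∑-suc f))

  det-Determinant : ∀ n M → det n M ≋ Detᴾ.det n M
  det-Determinant zero    M = 𝕊.refl
  det-Determinant (suc n) M = 𝕊.trans (sumFP-∑ (suc n) _) (∑ᴾ.∑-cong λ j →
    𝕊.*-cong (*ₚ-congʳ (M zero j) (sign-sgn (toℕ j))) (det-Determinant n (Detᴾ.minor j M)))

  -- The Euler operator, its differential equations and the exponential

  euler : PS → PS
  euler f n = fromℕ n * f n

  -- Shifting does not commute with `euler`: `tail (euler f)` is `tail f +ₚ euler (tail f)`. The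
  -- extra `tail f` accounts for the 1 in the factor `1 + n`.
  euler-* : ∀ f g → euler (f *ₚ g) ≈ₚ (euler f *ₚ g) +ₚ (f *ₚ euler g)
  euler-* f g zero = begin
    0# * (f *ₚ g) 0                                 ≈⟨ zeroˡ _ ⟩
    0#                                              ≈⟨ solve 1 (λ z → z := z :+ (z :- z)) refl 0# ⟩
    0# + (0# - 0#)                                  ≈⟨ +-cong (sym (trans (*ₚ-zero (euler f) g) (trans (*-congʳ (zeroˡ _)) (zeroˡ _))))
                                                          (trans (-‿inverseʳ 0#) (sym (trans (*ₚ-zero f (euler g)) (trans (*-congˡ (zeroˡ _)) (zeroʳ _))))) ⟩
    (euler f *ₚ g) 0 + (f *ₚ euler g) 0             ∎
  euler-* f g (suc n) = begin
    (1# + fromℕ n) * (f 0 * g (suc n) + (tail f *ₚ g) n)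
      ≈⟨ solve 5 (λ e k a b x → (e :+ k) :* (a :* b :+ x) := (e :+ k) :* (a :* b) :+ (e :* x :+ k :* x)) refl 1# (fromℕ n) (f 0) (g (suc n)) _ ⟩
    (1# + fromℕ n) * (f 0 * g (suc n)) + (1# * (tail f *ₚ g) n + fromℕ n * (tail f *ₚ g) n)
      ≈⟨ +-congˡ (+-cong (*-identityˡ _) (euler-* (tail f) g n)) ⟩
    (1# + fromℕ n) * (f 0 * g (suc n)) + ((tail f *ₚ g) n + ((euler (tail f) *ₚ g) n + (tail f *ₚ euler g) n))
      ≈⟨ solve 6 (λ k a b x y z → k :* (a :* b) :+ (x :+ (y :+ z)) := (x :+ y) :+ (a :* (k :* b) :+ z)) refl
           (1# + fromℕ n) (f 0) (g (suc n)) _ _ _ ⟩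
    ((tail f *ₚ g) n + (euler (tail f) *ₚ g) n) + (f *ₚ euler g) (suc n)
      ≈⟨ +-congʳ (*ₚ-distribʳ g (tail f) (euler (tail f)) n) ⟨
    ((tail f +ₚ euler (tail f)) *ₚ g) n + (f *ₚ euler g) (suc n)
      ≈⟨ +-congʳ (*ₚ-cong {tail f +ₚ euler (tail f)} {tail (euler f)} {g} (λ i → trans (+-congʳ (sym (*-identityˡ _))) (sym (distribʳ _ _ _))) (λ _ → refl) n) ⟩
    (tail (euler f) *ₚ g) n + (f *ₚ euler g) (suc n)
      ≈⟨ +-congʳ (trans (+-congʳ (trans (*-congʳ (zeroˡ _)) (zeroˡ _))) (+-identityˡ _)) ⟨
    (euler f *ₚ g) (suc n) + (f *ₚ euler g) (suc n) ∎

  eulerDerivation : Detᴾ.Derivation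
  eulerDerivation = record
    { E = euler
    ; E-cong = λ p → coefficientwise λ n → *-congˡ (at p n)
    ; E-+ = λ f g → coefficientwise λ n → distribˡ _ _ _
    ; E-* = λ f g → coefficientwise (euler-* f g)
    }

  euler-constP : ∀ x → euler (constP x) ≋ constP 0#
  euler-constP x = coefficientwise λ { zero → zeroˡ _ ; (suc n) → zeroʳ _ }

  euler-tP : euler tP ≋ tP
  euler-tP = coefficientwise λ
    { zero → zeroʳ _ ; (suc zero) → trans (*-identityʳ _) (+-identityʳ _) ; (suc (suc n)) → zeroʳ _ }

  module _ (inverse : ∀ k → fromℕ (suc k) * inv k ≈ 1#) where

    torsion-free : ∀ k x → fromℕ (suc k) * x ≈ 0# → x ≈ 0#
    torsion-free k x eq = begin
      x                                ≈⟨ *-identityˡ _ ⟨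
      1# * x                           ≈⟨ *-congʳ (inverse k) ⟨
      fromℕ (suc k) * inv k * x        ≈⟨ solve 3 (λ k i x → k :* i :* x := i :* (k :* x)) refl (fromℕ (suc k)) (inv k) x ⟩
      inv k * (fromℕ (suc k) * x)      ≈⟨ trans (*-congˡ eq) (zeroʳ _) ⟩
      0#                               ∎

    -- As `s` starts with 1 and `p` with 0, coefficient `m + 1` of the equation expresses
    -- `(m + 1) d (m + 1)` through earlier coefficients of `d`. The bound `n` makes this strong
    -- induction structural.
    euler-unique-zero : ∀ s p d → s 0 ≈ 1# → p 0 ≈ 0# → d 0 ≈ 0# →
      s *ₚ euler d ≈ₚ p *ₚ d → ∀ n m → m ≤ n → d m ≈ 0#
    euler-unique-zero s p d s₀ p₀ d₀ eq n       zero    _         = d₀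
    euler-unique-zero s p d s₀ p₀ d₀ eq (suc n) (suc m) (s≤s m≤n) = torsion-free m _ (begin
      euler d (suc m)                                  ≈⟨ *-identityˡ _ ⟨
      1# * euler d (suc m)                             ≈⟨ *-congʳ s₀ ⟨
      s 0 * euler d (suc m)                            ≈⟨ trans (+-congˡ (*ₚ-vanish m (tail s) (euler d) λ k k≤m → trans (*-congˡ (below k k≤m)) (zeroʳ _))) (+-identityʳ _) ⟨
      (s *ₚ euler d) (suc m)                           ≈⟨ eq (suc m) ⟩
      p 0 * d (suc m) + (tail p *ₚ d) m                ≈⟨ +-cong (trans (*-congʳ p₀) (zeroˡ _)) (*ₚ-vanish m (tail p) d below) ⟩
      0# + 0#                                          ≈⟨ +-identityʳ _ ⟩
      0#                                               ∎)
      where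
      below : ∀ k → k ≤ m → d k ≈ 0#
      below k k≤m = euler-unique-zero s p d s₀ p₀ d₀ eq n k (ℕ.≤-trans k≤m m≤n)

    euler-unique : ∀ s p f g → s 0 ≈ 1# → p 0 ≈ 0# → f 0 ≈ g 0 →
      (s *ₚ euler f) ≋ (p *ₚ f) → (s *ₚ euler g) ≋ (p *ₚ g) → f ≋ g
    euler-unique s p f g s₀ p₀ f₀≈g₀ eq-f eq-g = coefficientwise λ n → begin
      f n                  ≈⟨ solve 2 (λ x y → x := (x :- y) :+ y) refl (f n) (g n) ⟩
      (f n - g n) + g n    ≈⟨ +-congʳ (euler-unique-zero s p (f -ₚ g) s₀ p₀ (trans (+-congʳ f₀≈g₀) (-‿inverseʳ _)) (at difference) n n ℕ.≤-refl) ⟩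
      0# + g n             ≈⟨ +-identityˡ _ ⟩
      g n                  ∎
      where
      open Detᴾ.Derivation eulerDerivation
      difference : (s *ₚ euler (f -ₚ g)) ≋ (p *ₚ (f -ₚ g))
      difference = 𝕊.trans (*ₚ-congˡ s (𝕊.trans (E-+ f (-ₚ g)) (𝕊.+-congˡ (E-neg g))))
        (𝕊.trans (𝕊.distribˡ s _ _) (𝕊.trans (𝕊.+-cong eq-f
          (𝕊.trans (𝕊.sym (-‿distribʳ-* s _)) (𝕊.trans (𝕊.-‿cong eq-g) (-‿distribʳ-* p g)))) (𝕊.sym (𝕊.distribˡ p _ _))))
        where open import Algebra.Properties.Ring 𝕊.ring using (-‿distribʳ-*)

    open Detᴾ.Derivation eulerDerivation using (E-cong; E-+; E-*)
    open RingIdentities powerSeriesRing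
    import Relation.Binary.Reasoning.Setoid 𝕊.setoid as ≋-Reasoning

    euler-^ : ∀ f m → euler (f ^ₚ suc m) ≋ (constP (fromℕ (suc m)) *ₚ (euler f *ₚ f ^ₚ m))
    euler-^ f zero = ≋-Reasoning.begin
      euler (f *ₚ constP 1#)                                   ≋-Reasoning.≈⟨ E-* f (constP 1#) ⟩
      (euler f *ₚ constP 1#) +ₚ (f *ₚ euler (constP 1#))       ≋-Reasoning.≈⟨ 𝕊.+-congˡ (𝕊.trans (*ₚ-congˡ f (euler-constP 1#)) (𝕊.zeroʳ f)) ⟩
      (euler f *ₚ constP 1#) +ₚ constP 0#                      ≋-Reasoning.≈⟨ 𝕊.+-identityʳ _ ⟩
      euler f *ₚ constP 1#                                     ≋-Reasoning.≈⟨ 𝕊.*-identityˡ _ ⟨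
      constP 1# *ₚ (euler f *ₚ constP 1#)                      ≋-Reasoning.≈⟨ 𝕊.*-congʳ (constP-cong (+-identityʳ 1#)) ⟨
      constP (fromℕ 1) *ₚ (euler f *ₚ constP 1#)               ≋-Reasoning.∎
    euler-^ f (suc m) = ≋-Reasoning.begin
      euler (f *ₚ f ^ₚ suc m)                                  ≋-Reasoning.≈⟨ E-* f (f ^ₚ suc m) ⟩
      (euler f *ₚ f ^ₚ suc m) +ₚ (f *ₚ euler (f ^ₚ suc m))     ≋-Reasoning.≈⟨ 𝕊.+-congˡ (*ₚ-congˡ f (euler-^ f m)) ⟩
      (euler f *ₚ f ^ₚ suc m) +ₚ (f *ₚ (constP (fromℕ (suc m)) *ₚ (euler f *ₚ f ^ₚ m)))
        ≋-Reasoning.≈⟨ power-rule (constP (fromℕ (suc m))) (euler f) f (f ^ₚ m) ⟩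
      (constP 1# +ₚ constP (fromℕ (suc m))) *ₚ (euler f *ₚ f ^ₚ suc m)
        ≋-Reasoning.≈⟨ 𝕊.*-congʳ (constP-+ 1# (fromℕ (suc m))) ⟨
      constP (fromℕ (suc (suc m))) *ₚ (euler f *ₚ f ^ₚ suc m)  ≋-Reasoning.∎

    -- The first `m` terms of the exponential series. `expP` truncates differently at each
    -- coefficient; a partial sum of fixed length is an honest finite sum of series, which the
    -- derivation rules can handle.
    expTo : ℕ → PS → PS
    expTo zero    f = constP 0#
    expTo (suc m) f = expTo m f +ₚ (constP (invFact m) *ₚ f ^ₚ m)

    -- `E` takes fʲ/j! to `E f` times fʲ⁻¹/(j-1)!, and the term for j = 0 to zero, so one term is
    -- lost.
    euler-expTo : ∀ m f → euler (expTo (suc m) f) ≋ (euler f *ₚ expTo m f)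
    euler-expTo zero f = ≋-Reasoning.begin
      euler (constP 0# +ₚ (constP 1# *ₚ constP 1#))      ≋-Reasoning.≈⟨ E-cong (𝕊.trans (𝕊.+-identityˡ _) (𝕊.*-identityˡ _)) ⟩
      euler (constP 1#)                                  ≋-Reasoning.≈⟨ euler-constP 1# ⟩
      constP 0#                                          ≋-Reasoning.≈⟨ 𝕊.zeroʳ (euler f) ⟨
      euler f *ₚ constP 0#                               ≋-Reasoning.∎
    euler-expTo (suc m) f = ≋-Reasoning.begin
      euler (expTo (suc m) f +ₚ (constP (invFact (suc m)) *ₚ f ^ₚ suc m))
        ≋-Reasoning.≈⟨ E-+ (expTo (suc m) f) (constP (invFact (suc m)) *ₚ f ^ₚ suc m) ⟩
      euler (expTo (suc m) f) +ₚ euler (constP (invFact (suc m)) *ₚ f ^ₚ suc m)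
        ≋-Reasoning.≈⟨ 𝕊.+-cong (euler-expTo m f) term ⟩
      (euler f *ₚ expTo m f) +ₚ (euler f *ₚ (constP (invFact m) *ₚ f ^ₚ m))
        ≋-Reasoning.≈⟨ 𝕊.distribˡ (euler f) _ _ ⟨
      euler f *ₚ expTo (suc m) f ≋-Reasoning.∎
      where
      invFact-suc : invFact (suc m) * fromℕ (suc m) ≈ invFact m
      invFact-suc = begin
        inv m * invFact m * fromℕ (suc m)       ≈⟨ solve 3 (λ i f k → i :* f :* k := (k :* i) :* f) refl (inv m) (invFact m) (fromℕ (suc m)) ⟩
        fromℕ (suc m) * inv m * invFact m       ≈⟨ *-congʳ (inverse m) ⟩
        1# * invFact m                          ≈⟨ *-identityˡ _ ⟩
        invFact m                               ∎
      term : euler (constP (invFact (suc m)) *ₚ f ^ₚ suc m) ≋ (euler f *ₚ (constP (invFact m) *ₚ f ^ₚ m))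
      term = ≋-Reasoning.begin
        euler (constP (invFact (suc m)) *ₚ f ^ₚ suc m)
          ≋-Reasoning.≈⟨ E-* (constP (invFact (suc m))) (f ^ₚ suc m) ⟩
        (euler (constP (invFact (suc m))) *ₚ f ^ₚ suc m) +ₚ (constP (invFact (suc m)) *ₚ euler (f ^ₚ suc m))
          ≋-Reasoning.≈⟨ 𝕊.+-cong (𝕊.trans (𝕊.*-congʳ (euler-constP _)) (𝕊.zeroˡ _)) (*ₚ-congˡ (constP (invFact (suc m))) (euler-^ f m)) ⟩
        constP 0# +ₚ (constP (invFact (suc m)) *ₚ (constP (fromℕ (suc m)) *ₚ (euler f *ₚ f ^ₚ m)))
          ≋-Reasoning.≈⟨ 𝕊.trans (𝕊.+-identityˡ _) (rotate (constP (invFact (suc m))) (constP (fromℕ (suc m))) (euler f) (f ^ₚ m)) ⟩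
        euler f *ₚ ((constP (invFact (suc m)) *ₚ constP (fromℕ (suc m))) *ₚ f ^ₚ m)
          ≋-Reasoning.≈⟨ *ₚ-congˡ (euler f) (*ₚ-congʳ (f ^ₚ m) (𝕊.trans (𝕊.sym (constP-* _ _)) (constP-cong invFact-suc))) ⟩
        euler f *ₚ (constP (invFact m) *ₚ f ^ₚ m) ≋-Reasoning.∎

    sumF-last : ∀ n (h : ℕ → Carrier) → sumF (suc n) (λ i → h (toℕ i)) ≈ sumF n (λ i → h (toℕ i)) + h n
    sumF-last zero    h = +-comm _ _
    sumF-last (suc n) h = trans (+-congˡ (sumF-last n (h ∘ suc))) (sym (+-assoc _ _ _))

    module _ (f : PS) (f₀ : f 0 ≈ 0#) where

      ^ₚ-vanish : ∀ k n → n < k → (f ^ₚ k) n ≈ 0#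
      ^ₚ-vanish (suc k) zero    _         = trans (*ₚ-zero f (f ^ₚ k)) (trans (*-congʳ f₀) (zeroˡ _))
      ^ₚ-vanish (suc k) (suc n) (s≤s n<k) = trans
        (+-cong (trans (*-congʳ f₀) (zeroˡ _)) (*ₚ-vanish n (tail f) (f ^ₚ k) λ m m≤n → ^ₚ-vanish k m (ℕ.≤-<-trans m≤n n<k)))
        (+-identityʳ _)

      expTo-sumF : ∀ m n → expTo m f n ≈ sumF m (λ j → invFact (toℕ j) * (f ^ₚ toℕ j) n)
      expTo-sumF zero    zero    = refl
      expTo-sumF zero    (suc n) = refl
      expTo-sumF (suc m) n       = trans (+-cong (expTo-sumF m n) (constP-*ₚ _ (f ^ₚ m) n))
        (sym (sumF-last m (λ j → invFact j * (f ^ₚ j) n)))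

      -- Without constant term in `f`, the power fʲ has no coefficient below tʲ, so the terms after
      -- the first `n + 1` leave coefficient `n` unchanged.
      expTo-expP : ∀ d n → expTo (d ℕ.+ suc n) f n ≈ expP f n
      expTo-expP zero    n = expTo-sumF (suc n) n
      expTo-expP (suc d) n = trans
        (+-cong (expTo-expP d n) (trans (constP-*ₚ _ (f ^ₚ (d ℕ.+ suc n)) n)
          (trans (*-congˡ (^ₚ-vanish (d ℕ.+ suc n) n (ℕ.m≤n+m (suc n) d))) (zeroʳ _))))
        (+-identityʳ _)

      euler-expP : euler (expP f) ≋ (euler f *ₚ expP f)
      euler-expP = coefficientwise λ n → begin
        fromℕ n * expP f n             ≈⟨ *-congˡ (expTo-expP 0 n) ⟨
        euler (expTo (suc n) f) n      ≈⟨ at (euler-expTo n f) n ⟩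
        (euler f *ₚ expTo n f) n       ≈⟨ truncate n ⟩
        (euler f *ₚ expP f) n          ∎
        where
        -- `expTo n f` is exact only in degrees below `n`. That suffices: `euler f` has no constant
        -- term, so degree `n` of the second factor is multiplied by zero.
        truncate : ∀ n → (euler f *ₚ expTo n f) n ≈ (euler f *ₚ expP f) n
        truncate zero    = +-congʳ (trans (trans (*-congʳ (zeroˡ _)) (zeroˡ _)) (sym (trans (*-congʳ (zeroˡ _)) (zeroˡ _))))
        truncate (suc n) = +-cong (trans (trans (*-congʳ (zeroˡ _)) (zeroˡ _)) (sym (trans (*-congʳ (zeroˡ _)) (zeroˡ _))))
          (*ₚ-cong-≤ n {tail (euler f)} (λ _ → refl) λ m m≤n →
            trans (reflexive (≡.cong (λ k → expTo k f m) (≡.sym (≡.trans (ℕ.+-suc (n ℕ.∸ m) m) (≡.cong suc (ℕ.m∸n+n≡m m≤n))))))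
              (expTo-expP (n ℕ.∸ m) m))

-- Arcs, indicators and sums over arcs

invA-involutive : ∀ G a → invA G (invA G a) ≡ a
invA-involutive G (e , false) = ≡.refl
invA-involutive G (e , true)  = ≡.refl

headA-invA : ∀ G a → headA G (invA G a) ≡ tailA G a
headA-invA G (e , false) = ≡.refl
headA-invA G (e , true)  = ≡.refl

invA≢ : ∀ G a → invA G a ≢ a
invA≢ G (e , false) ()
invA≢ G (e , true)  ()

module Indicator {c ℓ} (S : CommutativeRing c ℓ) where
  open CommutativeRing S

  χ : ∀ {p} {P : Set p} → Dec P → Carrier
  χ d = if ⌊ d ⌋ then 1# else 0#

  χ-yes : ∀ {p} {P : Set p} (d : Dec P) → P → χ d ≈ 1#
  χ-yes (yes _) p = refl
  χ-yes (no ¬p) p = ⊥-elim (¬p p)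

  χ-no : ∀ {p} {P : Set p} (d : Dec P) → ¬ P → χ d ≈ 0#
  χ-no (yes p) ¬p = ⊥-elim (¬p p)
  χ-no (no _)  ¬p = refl

  χ-⇔ : ∀ {p q} {P : Set p} {Q : Set q} (d : Dec P) (d′ : Dec Q) → (P → Q) → (Q → P) → χ d ≈ χ d′
  χ-⇔ (yes p) d′ f g = sym (χ-yes d′ (f p))
  χ-⇔ (no ¬p) d′ f g = sym (χ-no d′ (¬p ∘ g))

module ArcSum {c ℓ} (S : CommutativeRing c ℓ) (G : Graph) where
  open CommutativeRing S hiding (zero)
  open Graph G
  open FiniteSum S
  open Indicator S
  open EnumeratedSum S (lookup (allArcs G)) public

  -- Generalized from the list of all edges to `tabulate g`, because the rest of a tabulation is the
  -- tabulation of `g ∘ suc`.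
  ∑-lookup-arcs : ∀ {n} (g : Fin n → Fin nE) (f : Arc G → Carrier) →
    ∑ (λ i → f (lookup (concatMap (λ e → (e , false) ∷ (e , true) ∷ []) (tabulate g)) i))
      ≈ ∑ (λ e → f (g e , false) + f (g e , true))
  ∑-lookup-arcs {zero}  g f = trans (∑-empty _) (sym (∑-empty _))
  ∑-lookup-arcs {suc n} g f = trans (∑-suc _) (trans (+-congˡ (∑-suc _)) (trans (sym (+-assoc _ _ _))
    (trans (+-congˡ (∑-lookup-arcs (g ∘ suc) f)) (sym (∑-suc _)))))

  Σₐ-edges : ∀ f → Σₐ f ≈ ∑ (λ e → f (e , false) + f (e , true))
  Σₐ-edges f = trans (Σₐ-∑ f) (∑-lookup-arcs id f)

  Σₐ-inv : ∀ (f : Arc G → Carrier) → Σₐ (λ a → f (invA G a)) ≈ Σₐ f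
  Σₐ-inv f = trans (Σₐ-edges (λ a → f (invA G a))) (trans (∑-cong λ e → +-comm _ _) (sym (Σₐ-edges f)))

  δₐ : Arc G → Arc G → Carrier
  δₐ a b = χ (_≟A_ G a b)

  δₐ-sym : ∀ a b → δₐ a b ≈ δₐ b a
  δₐ-sym a b = χ-⇔ (_≟A_ G a b) (_≟A_ G b a) ≡.sym ≡.sym

  δₐ-sum : ∀ a (f : Arc G → Carrier) → Σₐ (λ b → δₐ a b * f b) ≈ f a
  δₐ-sum (e , x) f = trans (Σₐ-edges (λ b → δₐ (e , x) b * f b)) (trans
    (∑-single e _ (λ e′ e′≢e → trans (+-cong
      (off (λ eq → e′≢e (≡.sym (≡.cong proj₁ eq)))) (off (λ eq → e′≢e (≡.sym (≡.cong proj₁ eq))))) (+-identityʳ _)))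
    (at-e x))
    where
    off : ∀ {a b} → a ≢ b → δₐ a b * f b ≈ 0#
    off {a} {b} a≢b = trans (*-congʳ (χ-no (_≟A_ G a b) a≢b)) (zeroˡ _)
    on : ∀ a → δₐ a a * f a ≈ f a
    on a = trans (*-congʳ (χ-yes (_≟A_ G a a) ≡.refl)) (*-identityˡ _)
    at-e : ∀ x → δₐ (e , x) (e , false) * f (e , false) + δₐ (e , x) (e , true) * f (e , true) ≈ f (e , x)
    at-e false = trans (+-cong (on (e , false)) (off {e , false} {e , true} (λ ()))) (+-identityʳ _)
    at-e true  = trans (+-cong (off {e , true} {e , false} (λ ())) (on (e , true))) (+-identityˡ _)

  δₐ-inv : ∀ a → δₐ (invA G a) a ≈ 0#
  δₐ-inv a = χ-no (_≟A_ G (invA G a) a) (invA≢ G a)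

  trδₐ-edges : Σₐ (λ a → δₐ a a) ≈ ∑ {nE} (λ e → 1# + 1#)
  trδₐ-edges = trans (Σₐ-edges (λ a → δₐ a a)) (∑-cong λ e →
    +-cong (χ-yes (_≟A_ G (e , false) (e , false)) ≡.refl) (χ-yes (_≟A_ G (e , true) (e , true)) ≡.refl))

  δᵥ : Fin nV → Fin nV → Carrier
  δᵥ u v = χ (u ≟F v)

  δᵥ-sym : ∀ u v → δᵥ u v ≈ δᵥ v u
  δᵥ-sym u v = χ-⇔ (u ≟F v) (v ≟F u) ≡.sym ≡.sym

  δᵥ-sum : ∀ u (f : Fin nV → Carrier) → ∑ (λ v → δᵥ u v * f v) ≈ f u
  δᵥ-sum u f = trans
    (∑-single u _ (λ v v≢u → trans (*-congʳ (χ-no (u ≟F v) (v≢u ∘ ≡.sym))) (zeroˡ _)))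
    (trans (*-congʳ (χ-yes (u ≟F u) ≡.refl)) (*-identityˡ _))

-- The loops inside isClosed and circ are local to Defs; they are recovered here by unification.
isClosed-loop : ∀ G → ∃ λ (loop : Arc G → Arc G → List (Arc G) → Bool) →
    (∀ c x xs → isClosed G (c ∷ x ∷ xs) ≡ ⌊ headA G c ≟F tailA G x ⌋ ∧ loop c x xs)
  × (∀ c x → loop c x [] ≡ ⌊ headA G x ≟F tailA G c ⌋)
  × (∀ c x y ys → loop c x (y ∷ ys) ≡ ⌊ headA G x ≟F tailA G y ⌋ ∧ loop c y ys)
isClosed-loop G = _ , (λ c x xs → ≡.refl) , (λ c x → ≡.refl) , (λ c x y ys → ≡.refl)

circ-loop : ∀ {c ℓ} (R : CommutativeRing c ℓ) (inv : ℕ → CommutativeRing.Carrier R) G (τ₁ τ₂ : Arc G → CommutativeRing.Carrier R) →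
  let open CommutativeRing R; open Zeta R inv in
  ∃ λ (loop : Arc G → Arc G → List (Arc G) → Carrier) →
    (∀ c x xs → circ G τ₁ τ₂ (c ∷ x ∷ xs) ≡ θ G τ₁ τ₂ c x * loop c x xs)
  × (∀ c x → loop c x [] ≡ θ G τ₁ τ₂ x c)
  × (∀ c x y ys → loop c x (y ∷ ys) ≡ θ G τ₁ τ₂ x y * loop c y ys)
circ-loop R inv G τ₁ τ₂ = _ , (λ c x xs → ≡.refl) , (λ c x → ≡.refl) , (λ c x y ys → ≡.refl)

-- Closed paths as traces of powers of the arc matrix

module Trace {c ℓ} (R : CommutativeRing c ℓ) (inv : ℕ → CommutativeRing.Carrier R) (G : Graph) (τ₁ τ₂ : Arc G → CommutativeRing.Carrier R) where
  open CommutativeRing R hiding (zero)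
  open Zeta R inv
  open Graph G
  open Indicator R
  open FiniteSum R
  open ArcSum R G
  open IntegerCoefficientSolver R
  open import Relation.Binary.Reasoning.Setoid setoid

  Θ : Arc G → Arc G → Carrier
  Θ = θ G τ₁ τ₂

  U : Arc G → Arc G → Carrier
  U a b = τ₁ a * τ₂ b * δ ⌊ headA G a ≟F tailA G b ⌋

  Θ-nonadjacent : ∀ a b → headA G a ≢ tailA G b → Θ a b ≈ 0#
  Θ-nonadjacent a b h≢t = begin
    U a b - δ ⌊ _≟A_ G b (invA G a) ⌋
      ≈⟨ +-cong (trans (*-congˡ (χ-no (headA G a ≟F tailA G b) h≢t)) (zeroʳ _))
           (-‿cong (χ-no (_≟A_ G b (invA G a)) λ { ≡.refl → h≢t (headA≡tailA-invA a) })) ⟩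
    0# - 0#   ≈⟨ -‿inverseʳ 0# ⟩
    0#        ∎
    where
    headA≡tailA-invA : ∀ a → headA G a ≡ tailA G (invA G a)
    headA≡tailA-invA (e , false) = ≡.refl
    headA≡tailA-invA (e , true)  = ≡.refl

  closedLoop : Arc G → Arc G → List (Arc G) → Bool
  closedLoop = proj₁ (isClosed-loop G)

  circLoop : Arc G → Arc G → List (Arc G) → Carrier
  circLoop = proj₁ (circ-loop R inv G τ₁ τ₂)

  weight : Arc G → Arc G → List (Arc G) → Carrier
  weight c x []       = Θ x c
  weight c x (y ∷ ys) = Θ x y * weight c y ys

  circLoop-weight : ∀ c x xs → circLoop c x xs ≡ weight c x xs
  circLoop-weight c x []       = proj₁ (proj₂ (proj₂ (circ-loop R inv G τ₁ τ₂))) c x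
  circLoop-weight c x (y ∷ ys) = ≡.trans (proj₂ (proj₂ (proj₂ (circ-loop R inv G τ₁ τ₂))) c x y ys) (≡.cong (Θ x y *_) (circLoop-weight c y ys))

  guard-* : ∀ {P : Set} (d : Dec P) b x w → (¬ P → x ≈ 0#) → (if b then w else 0#) ≈ w →
    (if ⌊ d ⌋ ∧ b then x * w else 0#) ≈ x * w
  guard-* (no ¬p) b     x w x≈0 eq = sym (trans (*-congʳ (x≈0 ¬p)) (zeroˡ _))
  guard-* (yes _) true  x w x≈0 eq = refl
  guard-* (yes _) false x w x≈0 eq = trans (sym (zeroʳ _)) (*-congˡ eq)

  guard : ∀ {P : Set} (d : Dec P) x → (¬ P → x ≈ 0#) → (if ⌊ d ⌋ then x else 0#) ≈ x
  guard (yes _) x x≈0 = refl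
  guard (no ¬p) x x≈0 = sym (x≈0 ¬p)

  closedLoop-guard : ∀ c x xs → (if closedLoop c x xs then weight c x xs else 0#) ≈ weight c x xs
  closedLoop-guard c x [] = guard (headA G x ≟F tailA G c) (Θ x c) (Θ-nonadjacent x c)
  closedLoop-guard c x (y ∷ ys) = guard-* (headA G x ≟F tailA G y) (closedLoop c y ys) (Θ x y) (weight c y ys) (Θ-nonadjacent x y) (closedLoop-guard c y ys)

  isClosed-guard : ∀ c cs → (if isClosed G (c ∷ cs) then circ G τ₁ τ₂ (c ∷ cs) else 0#) ≈ weight c c cs
  isClosed-guard c []       = guard (headA G c ≟F tailA G c) (Θ c c) (Θ-nonadjacent c c)
  isClosed-guard c (x ∷ xs) = trans
    (reflexive (≡.cong (λ w → if isClosed G (c ∷ x ∷ xs) then Θ c x * w else 0#) (circLoop-weight c x xs)))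
    (guard-* (headA G c ≟F tailA G x) (closedLoop c x xs) (Θ c x) (weight c x xs) (Θ-nonadjacent c x) (closedLoop-guard c x xs))

  sumMap : ∀ {a} {A : Set a} → (A → Carrier) → List A → Carrier
  sumMap f xs = sumL (map f xs)

  sumMap-cong : ∀ {a} {A : Set a} {f g : A → Carrier} → (∀ x → f x ≈ g x) → ∀ xs → sumMap f xs ≈ sumMap g xs
  sumMap-cong eq []       = refl
  sumMap-cong eq (x ∷ xs) = +-cong (eq x) (sumMap-cong eq xs)

  sumMap-* : ∀ {a} {A : Set a} y (f : A → Carrier) xs → sumMap (λ x → y * f x) xs ≈ y * sumMap f xs
  sumMap-* y f []       = sym (zeroʳ _)
  sumMap-* y f (x ∷ xs) = trans (+-congˡ (sumMap-* y f xs)) (sym (distribˡ _ _ _))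

  sumMap-++ : ∀ {a} {A : Set a} (f : A → Carrier) xs ys → sumMap f (xs ++ ys) ≈ sumMap f xs + sumMap f ys
  sumMap-++ f []       ys = sym (+-identityˡ _)
  sumMap-++ f (x ∷ xs) ys = trans (+-congˡ (sumMap-++ f xs ys)) (sym (+-assoc _ _ _))

  sumMap-concatMap : ∀ {a b} {A : Set a} {B : Set b} (f : B → Carrier) (h : A → List B) xs →
    sumMap f (concatMap h xs) ≈ sumMap (λ x → sumMap f (h x)) xs
  sumMap-concatMap f h []       = refl
  sumMap-concatMap f h (x ∷ xs) = trans (sumMap-++ f (h x) (concatMap h xs)) (+-congˡ (sumMap-concatMap f h xs))

  sumMap-∑ : ∀ {a} {A : Set a} (f : A → Carrier) xs → sumMap f xs ≈ ∑ (λ i → f (lookup xs i))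
  sumMap-∑ f []       = sym (∑-empty _)
  sumMap-∑ f (x ∷ xs) = trans (+-congˡ (sumMap-∑ f xs)) (sym (∑-suc _))

  sumMap-Σₐ : ∀ f → sumMap f (allArcs G) ≈ Σₐ f
  sumMap-Σₐ f = trans (sumMap-∑ f (allArcs G)) (sym (Σₐ-∑ f))

  sumMap-allSeqs : ∀ (f : List (Arc G) → Carrier) k → sumMap f (allSeqs G (suc k)) ≈ Σₐ (λ a → sumMap (λ as → f (a ∷ as)) (allSeqs G k))
  sumMap-allSeqs f k = begin
    sumMap f (concatMap (λ a → map (a ∷_) (allSeqs G k)) (allArcs G))
      ≈⟨ sumMap-concatMap f (λ a → map (a ∷_) (allSeqs G k)) (allArcs G) ⟩
    sumMap (λ a → sumMap f (map (a ∷_) (allSeqs G k))) (allArcs G)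
      ≈⟨ sumMap-cong (λ a → reflexive (≡.cong sumL (≡.sym (map-∘ (allSeqs G k))))) (allArcs G) ⟩
    sumMap (λ a → sumMap (λ as → f (a ∷ as)) (allSeqs G k)) (allArcs G)
      ≈⟨ sumMap-Σₐ _ ⟩
    Σₐ (λ a → sumMap (λ as → f (a ∷ as)) (allSeqs G k)) ∎

  Θ^ : ℕ → Arc G → Arc G → Carrier
  Θ^ zero    a b = δₐ a b
  Θ^ (suc n) a b = Σₐ λ c → Θ a c * Θ^ n c b

  Σₐδₐʳ : ∀ (f : Arc G → Carrier) b → Σₐ (λ c → f c * δₐ c b) ≈ f b
  Σₐδₐʳ f b = trans (Σₐ-cong λ c → trans (*-comm _ _) (*-congʳ (δₐ-sym c b))) (δₐ-sum b f)

  Θ^-suc′ : ∀ n a b → Θ^ (suc n) a b ≈ Σₐ (λ c → Θ^ n a c * Θ c b)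
  Θ^-suc′ zero    a b = trans (Σₐδₐʳ (Θ a) b) (sym (δₐ-sum a (λ c → Θ c b)))
  Θ^-suc′ (suc n) a b = begin
    Σₐ (λ c → Θ a c * Θ^ (suc n) c b)                    ≈⟨ Σₐ-cong (λ c → trans (*-congˡ (Θ^-suc′ n c b)) (*-Σₐ _ _)) ⟩
    Σₐ (λ c → Σₐ λ d → Θ a c * (Θ^ n c d * Θ d b))       ≈⟨ Σₐ-swap _ ⟩
    Σₐ (λ d → Σₐ λ c → Θ a c * (Θ^ n c d * Θ d b))       ≈⟨ Σₐ-cong (λ d → trans (Σₐ-cong λ c → sym (*-assoc _ _ _)) (sym (Σₐ-* _ _))) ⟩
    Σₐ (λ d → Θ^ (suc n) a d * Θ d b)                    ∎

  -- A walk from `x` through `k` further arcs and on to `c` makes `k + 1` transitions, hence the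
  -- exponent.
  weight-Θ^ : ∀ k c x → sumMap (weight c x) (allSeqs G k) ≈ Θ^ (suc k) x c
  weight-Θ^ zero    c x = trans (+-identityʳ _) (sym (Σₐδₐʳ (Θ x) c))
  weight-Θ^ (suc k) c x = trans (sumMap-allSeqs (weight c x) k)
    (Σₐ-cong λ y → trans (sumMap-* (Θ x y) (weight c y) (allSeqs G k)) (*-congˡ (weight-Θ^ k c y)))

  N-trace : ∀ k → N G τ₁ τ₂ (suc k) ≈ Σₐ (λ a → Θ^ (suc k) a a)
  N-trace k = trans (sumMap-allSeqs _ k) (Σₐ-cong λ a →
    trans (sumMap-cong (isClosed-guard a) (allSeqs G k)) (weight-Θ^ k a a))

  p : Arc G → Fin nV → Carrier
  p a v = if ⌊ headA G a ≟F v ⌋ then τ₁ a else 0#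

  q : Fin nV → Arc G → Carrier
  q v a = if ⌊ tailA G a ≟F v ⌋ then τ₂ a else 0#

  ∑pq : ∀ a b → ∑ (λ v → p a v * q v b) ≈ U a b
  ∑pq a b = trans (∑-single (headA G a) _ off) on
    where
    off : ∀ v → v ≢ headA G a → p a v * q v b ≈ 0#
    off v v≢h with headA G a ≟F v
    ... | yes h≡v = ⊥-elim (v≢h (≡.sym h≡v))
    ... | no _    = zeroˡ _
    on : p a (headA G a) * q (headA G a) b ≈ U a b
    -- `U` and `q` compare the same two vertices in opposite orders; both decisions are analysed and
    -- the contradictory outcomes refuted.
    on with headA G a ≟F headA G a | headA G a ≟F tailA G b | tailA G b ≟F headA G a
    ... | no h≢h | _       | _       = ⊥-elim (h≢h ≡.refl)
    ... | yes _  | yes h≡t | no t≢h  = ⊥-elim (t≢h (≡.sym h≡t))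
    ... | yes _  | no h≢t  | yes t≡h = ⊥-elim (h≢t (≡.sym t≡h))
    ... | yes _  | yes _   | yes _   = sym (*-identityʳ _)
    ... | yes _  | no _    | no _    = trans (zeroʳ _) (sym (zeroʳ _))

  Aθ-qp : ∀ u v → Aθ G τ₁ τ₂ u v ≈ Σₐ (λ a → q u a * p a v)
  Aθ-qp u v = trans (sumMap-Σₐ _) (Σₐ-cong term)
    where
    term : ∀ a → (if ⌊ tailA G a ≟F u ⌋ ∧ ⌊ headA G a ≟F v ⌋ then τ₁ a * τ₂ a else 0#) ≈ q u a * p a v
    term a with tailA G a ≟F u | headA G a ≟F v
    ... | yes _ | yes _ = *-comm _ _
    ... | yes _ | no _  = sym (zeroʳ _)
    ... | no _  | _     = sym (zeroˡ _)

  -- The head of the inverse of `a` is the tail of `a`, so a nonzero summand forces `u = v`; this is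
  -- why `QJP` is diagonal.
  Dθ-qp : ∀ u v → Dθ G τ₁ τ₂ u v ≈ Σₐ (λ a → q u a * p (invA G a) v)
  Dθ-qp u v = trans (*-congˡ (sumMap-Σₐ _)) (trans (*-Σₐ _ _) (Σₐ-cong term))
    where
    term : ∀ a → δ ⌊ u ≟F v ⌋ * (if ⌊ tailA G a ≟F u ⌋ then τ₁ (invA G a) * τ₂ a else 0#) ≈ q u a * p (invA G a) v
    term a rewrite headA-invA G a with u ≟F v | tailA G a ≟F u | tailA G a ≟F v
    ... | yes _      | yes _   | yes _  = trans (*-identityˡ _) (*-comm _ _)
    ... | yes ≡.refl | yes t≡u | no t≢v = ⊥-elim (t≢v t≡u)
    ... | no u≢v     | yes t≡u | yes t≡v = ⊥-elim (u≢v (≡.trans (≡.sym t≡u) t≡v))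
    ... | no _       | yes _   | no _   = trans (zeroˡ _) (sym (zeroʳ _))
    ... | _          | no _    | _      = trans (zeroʳ _) (sym (zeroˡ _))

  -- From `Θ + J = PQ`; this is the coefficient of tⁿ⁺¹ in `(I + tJ)X = I + tPQX`.
  Θ-recurrenceˡ : ∀ n a b → Θ^ (suc n) a b + Θ^ n (invA G a) b ≈ Σₐ (λ c → U a c * Θ^ n c b)
  Θ-recurrenceˡ n a b = begin
    Σₐ (λ c → Θ a c * Θ^ n c b) + Θ^ n (invA G a) b
      ≈⟨ +-cong (Σₐ-cong λ c → trans (*-congʳ (+-congˡ (-‿cong (δₐ-sym c (invA G a)))))
           (solve 3 (λ u d x → (u :- d) :* x := u :* x :- d :* x) refl (U a c) (δₐ (invA G a) c) (Θ^ n c b))) refl ⟩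
    Σₐ (λ c → U a c * Θ^ n c b - δₐ (invA G a) c * Θ^ n c b) + Θ^ n (invA G a) b
      ≈⟨ +-congʳ (trans (Σₐ-- _ _) (+-congˡ (-‿cong (δₐ-sum (invA G a) (λ c → Θ^ n c b))))) ⟩
    Σₐ (λ c → U a c * Θ^ n c b) - Θ^ n (invA G a) b + Θ^ n (invA G a) b
      ≈⟨ solve 2 (λ x y → x :- y :+ y := x) refl _ (Θ^ n (invA G a) b) ⟩
    Σₐ (λ c → U a c * Θ^ n c b) ∎

  Θ-recurrenceʳ : ∀ n a b → Θ^ (suc n) a b + Θ^ n a (invA G b) ≈ Σₐ (λ c → Θ^ n a c * U c b)
  Θ-recurrenceʳ n a b = begin
    Θ^ (suc n) a b + Θ^ n a (invA G b)
      ≈⟨ +-congʳ (trans (Θ^-suc′ n a b) (Σₐ-cong λ c → trans (*-congˡ (+-congˡ (-‿cong (flip c))))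
           (solve 3 (λ u d x → x :* (u :- d) := x :* u :- d :* x) refl (U c b) (δₐ (invA G b) c) (Θ^ n a c)))) ⟩
    Σₐ (λ c → Θ^ n a c * U c b - δₐ (invA G b) c * Θ^ n a c) + Θ^ n a (invA G b)
      ≈⟨ +-congʳ (trans (Σₐ-- _ _) (+-congˡ (-‿cong (δₐ-sum (invA G b) (Θ^ n a))))) ⟩
    Σₐ (λ c → Θ^ n a c * U c b) - Θ^ n a (invA G b) + Θ^ n a (invA G b)
      ≈⟨ solve 2 (λ x y → x :- y :+ y := x) refl _ (Θ^ n a (invA G b)) ⟩
    Σₐ (λ c → Θ^ n a c * U c b) ∎
    where
    -- `J` is symmetric because inversion is an involution.
    flip : ∀ c → δ ⌊ _≟A_ G b (invA G c) ⌋ ≈ δₐ (invA G b) c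
    flip c = χ-⇔ (_≟A_ G b (invA G c)) (_≟A_ G (invA G b) c)
      (λ { ≡.refl → invA-involutive G c }) (λ { ≡.refl → ≡.sym (invA-involutive G b) })

-- Logarithmic derivatives with denominator `s`

module LogarithmicDerivative {c ℓ} (S : CommutativeRing c ℓ) (𝓓 : Determinant.Derivation S) where
  open CommutativeRing S hiding (zero)
  open Determinant.Derivation 𝓓
  open IntegerCoefficientSolver S
  open import Relation.Binary.Reasoning.Setoid setoid
  open import Algebra.Properties.Semiring.Mult semiring using () renaming (_×_ to _·_; ×-homo-+ to ·-homo-+; ×-congˡ to ·-congˡ)

  -- s · E f = p · f says that the logarithmic derivative of f is p / s.
  LogD : Carrier → Carrier → Carrier → Set ℓ
  LogD s f p = s * E f ≈ p * f

  LogD-* : ∀ {s f g p q} → LogD s f p → LogD s g q → LogD s (f * g) (p + q)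
  LogD-* {s} {f} {g} {p} {q} Lf Lg = begin
    s * E (f * g)                     ≈⟨ *-congˡ (E-* f g) ⟩
    s * (E f * g + f * E g)           ≈⟨ solve 5 (λ s f g f′ g′ → s :* (f′ :* g :+ f :* g′) := (s :* f′) :* g :+ f :* (s :* g′)) refl s f g (E f) (E g) ⟩
    (s * E f) * g + f * (s * E g)     ≈⟨ +-cong (*-congʳ Lf) (*-congˡ Lg) ⟩
    (p * f) * g + f * (q * g)         ≈⟨ solve 4 (λ f g p q → (p :* f) :* g :+ f :* (q :* g) := (p :+ q) :* (f :* g)) refl f g p q ⟩
    (p + q) * (f * g)                 ∎

  LogD-1 : ∀ {s} → LogD s 1# 0#
  LogD-1 = trans (trans (*-congˡ E-1) (zeroʳ _)) (sym (zeroˡ _))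

  LogD-cong : ∀ {s f g p q} → f ≈ g → p ≈ q → LogD s f p → LogD s g q
  LogD-cong f≈g p≈q L = trans (*-congˡ (E-cong (sym f≈g))) (trans L (*-cong p≈q f≈g))

  module _ (t s : Carrier) (s+t²≈1 : s + t * t ≈ 1#) (Et : E t ≈ t) where

    w : Carrier
    w = - (t * t + t * t)

    Es : E s ≈ w
    Es = begin
      E s                             ≈⟨ solve 2 (λ x y → x := (x :+ y) :- y) refl (E s) (E (t * t)) ⟩
      E s + E (t * t) - E (t * t)     ≈⟨ +-cong (trans (sym (E-+ s (t * t))) (trans (E-cong s+t²≈1) E-1)) (-‿cong (trans (E-* t t) (+-cong (*-congʳ Et) (*-congˡ Et)))) ⟩
      0# - (t * t + t * t)            ≈⟨ +-identityˡ _ ⟩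
      w                               ∎

    LogD-s : LogD s s w
    LogD-s = trans (*-congˡ Es) (*-comm _ _)

    E-pencil : ∀ d a b → E d ≈ 0# → E a ≈ 0# → E b ≈ 0# →
      E ((s * d - t * a) + t * t * b) ≈ t * t * (b + b) - (t * a + t * t * (d + d))
    E-pencil d a b Ed Ea Eb = begin
      E ((s * d - t * a) + t * t * b)
        ≈⟨ trans (E-+ _ _) (+-congʳ (trans (E-+ _ _) (+-congˡ (E-neg _)))) ⟩
      E (s * d) - E (t * a) + E (t * t * b)
        ≈⟨ +-cong (+-cong (constant-factor Es Ed) (-‿cong (constant-factor Et Ea)))
             (constant-factor (trans (E-* t t) (+-cong (*-congʳ Et) (*-congˡ Et))) Eb) ⟩
      w * d - t * a + (t * t + t * t) * b
        ≈⟨ solve 4 (λ t d a b → :- (t :* t :+ t :* t) :* d :- t :* a :+ (t :* t :+ t :* t) :* b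
             := t :* t :* (b :+ b) :- (t :* a :+ t :* t :* (d :+ d))) refl t d a b ⟩
      t * t * (b + b) - (t * a + t * t * (d + d)) ∎
      where
      constant-factor : ∀ {x x′ y} → E x ≈ x′ → E y ≈ 0# → E (x * y) ≈ x′ * y
      constant-factor Ex Ey = trans (E-* _ _) (trans (+-cong (*-congʳ Ex) (trans (*-congˡ Ey) (zeroʳ _))) (+-identityʳ _))

    -- The part `d - t²d` merges into `s * d`. The shape `t * (t * 1#)` is what `tP ^ₚ 2` in `Mθ`
    -- unfolds to.
    pencil : ∀ d a b → d - t * a + t * (t * 1#) * (b - d) ≈ (s * d - t * a) + t * t * b
    pencil d a b = begin
      d - t * a + t * (t * 1#) * (b - d)
        ≈⟨ +-cong (+-congʳ (trans (sym (*-identityˡ d)) (*-congʳ (sym s+t²≈1)))) (*-congʳ (*-congˡ (*-identityʳ t))) ⟩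
      (s + t * t) * d - t * a + t * t * (b - d)
        ≈⟨ solve 5 (λ s t d a b → (s :+ t :* t) :* d :- t :* a :+ t :* t :* (b :- d) := (s :* d :- t :* a) :+ t :* t :* b) refl s t d a b ⟩
      (s * d - t * a) + t * t * b ∎

    -- As `w = -2t²`, the counts `d = 2|E|` and `v = |V|` give `t²d = -|E|w` and `2t²v = -|V|w`, so
    -- each edge and each vertex stands for one factor `s`. Truncated subtraction is balanced by
    -- `(nE ∸ nV) + nV = (nV ∸ nE) + nE`.
    exponents : ∀ nE nV trE x d v → trE + s * x + t * t * (v + v) ≈ d → d ≈ nE · (1# + 1#) → v ≈ nV · 1# →
      s * (x - d) + ((nE ∸ nV) · w + trE) ≈ (nV ∸ nE) · w
    exponents nE nV trE x d v trace d≈ v≈ = begin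
      s * (x - d) + ((nE ∸ nV) · w + trE)
        ≈⟨ solve 7 (λ s t x d v a e → s :* (x :- d) :+ (a :+ e)
             := (e :+ s :* x :+ t :* t :* (v :+ v)) :- (s :+ t :* t) :* d :+ (t :* t :* d :- t :* t :* (v :+ v) :+ a))
             refl s t x d v ((nE ∸ nV) · w) trE ⟩
      (trE + s * x + t * t * (v + v)) - (s + t * t) * d + (t * t * d - t * t * (v + v) + (nE ∸ nV) · w)
        ≈⟨ +-cong (trans (+-cong trace (-‿cong (trans (*-congʳ s+t²≈1) (*-identityˡ d)))) (-‿inverseʳ d))
             (+-congʳ (+-cong t²d (-‿cong t²v))) ⟩
      0# + (- (nE · w) - - (nV · w) + (nE ∸ nV) · w)
        ≈⟨ +-identityˡ _ ⟩
      - (nE · w) - - (nV · w) + (nE ∸ nV) · w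
        ≈⟨ solve 3 (λ e v a → :- e :- :- v :+ a := (a :+ v) :- e) refl (nE · w) (nV · w) ((nE ∸ nV) · w) ⟩
      ((nE ∸ nV) · w + nV · w) - nE · w
        ≈⟨ +-congʳ (trans (sym (·-homo-+ w (nE ∸ nV) nV)) (trans (·-congˡ (∸-balance nE nV)) (·-homo-+ w (nV ∸ nE) nE))) ⟩
      ((nV ∸ nE) · w + nE · w) - nE · w
        ≈⟨ solve 2 (λ b e → (b :+ e) :- e := b) refl ((nV ∸ nE) · w) (nE · w) ⟩
      (nV ∸ nE) · w ∎
      where
      ∸-balance : ∀ m n → (m ∸ n) ℕ.+ n ≡ (n ∸ m) ℕ.+ m
      ∸-balance m n with ℕ.≤-total m n
      ... | inj₁ m≤n = ≡.trans (≡.cong (ℕ._+ n) (ℕ.m≤n⇒m∸n≡0 m≤n)) (≡.sym (ℕ.m∸n+n≡m m≤n))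
      ... | inj₂ n≤m = ≡.trans (ℕ.m∸n+n≡m n≤m) (≡.sym (≡.cong (ℕ._+ m) (ℕ.m≤n⇒m∸n≡0 n≤m)))
      t²·neg : ∀ n → t * t * (n · (1# + 1#)) ≈ - (n · w)
      t²·neg zero    = trans (zeroʳ _) (sym -0#≈0#)
        where open import Algebra.Properties.Ring ring using (-0#≈0#)
      t²·neg (suc n) = begin
        t * t * ((1# + 1#) + n · (1# + 1#))
          ≈⟨ solve 3 (λ t e x → t :* t :* ((e :+ e) :+ x) := (e :* (t :* t) :+ e :* (t :* t)) :+ t :* t :* x) refl t 1# _ ⟩
        (1# * (t * t) + 1# * (t * t)) + t * t * (n · (1# + 1#))
          ≈⟨ +-cong (+-cong (*-identityˡ _) (*-identityˡ _)) (t²·neg n) ⟩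
        (t * t + t * t) - n · w
          ≈⟨ solve 2 (λ y x → y :- x := :- (:- y :+ x)) refl (t * t + t * t) (n · w) ⟩
        - (w + n · w) ∎
      t²d : t * t * d ≈ - (nE · w)
      t²d = trans (*-congˡ d≈) (t²·neg nE)
      double : ∀ n → n · 1# + n · 1# ≈ n · (1# + 1#)
      double zero    = +-identityʳ _
      double (suc n) = trans (solve 2 (λ e x → (e :+ x) :+ (e :+ x) := (e :+ e) :+ (x :+ x)) refl 1# (n · 1#)) (+-congˡ (double n))
      t²v : t * t * (v + v) ≈ - (nV · w)
      t²v = trans (*-congˡ (trans (+-cong v≈ v≈) (double nV))) (t²·neg nV)

-- The determinant formula for the zeta function

module WeightedZeta {c ℓ} (R : CommutativeRing c ℓ) (inv : ℕ → CommutativeRing.Carrier R) (G : Graph) (τ₁ τ₂ : Arc G → CommutativeRing.Carrier R) where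
  open CommutativeRing R hiding (zero)
  open Zeta R inv
  open Graph G
  open PowerSeries R inv
  open Trace R inv G τ₁ τ₂ using (Θ^; U; p; q; ∑pq; Aθ-qp; Dθ-qp; Θ-recurrenceˡ; Θ-recurrenceʳ; N-trace)
  module χᴿ = Indicator R
  module χᴾ = Indicator powerSeriesRing
  module Σᴿ = ArcSum R G
  module Σᴾ = ArcSum powerSeriesRing G
  module LD = LogarithmicDerivative powerSeriesRing eulerDerivation
  open import Relation.Binary.Reasoning.Setoid setoid
  open IntegerCoefficientSolver R
  open Detᴾ.Derivation eulerDerivation using (E-cong; jacobi)

  χ-constP : ∀ {ℓ′} {P : Set ℓ′} (d : Dec P) → χᴾ.χ d ≋ constP (χᴿ.χ d)
  χ-constP d with ⌊ d ⌋
  ... | true  = 𝕊.refl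
  ... | false = 𝕊.refl

  Σₐ-coefficient : ∀ (f : Arc G → PS) n → Σᴾ.Σₐ f n ≈ Σᴿ.Σₐ (λ a → f a n)
  Σₐ-coefficient f n = trans (at (Σᴾ.Σₐ-∑ f) n) (trans (∑-coefficient (λ i → f (lookup (allArcs G) i)) n) (sym (Σᴿ.Σₐ-∑ _)))

  constP-Σₐ : ∀ (f : Arc G → Carrier) → constP (Σᴿ.Σₐ f) ≋ Σᴾ.Σₐ (λ a → constP (f a))
  constP-Σₐ f = 𝕊.trans (constP-cong (Σᴿ.Σₐ-∑ f)) (𝕊.trans (constP-∑ (λ i → f (lookup (allArcs G) i))) (𝕊.sym (Σᴾ.Σₐ-∑ _)))

  P : Arc G → Fin nV → PS
  P a v = constP (p a v)

  Q : Fin nV → Arc G → PS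
  Q v a = constP (q v a)

  -- The geometric series of `tΘ`, read entrywise.
  X : Arc G → Arc G → PS
  X a b n = Θ^ n a b

  PQ : ∀ a b → ∑ᴾ.∑ (λ v → P a v *ₚ Q v b) ≋ constP (U a b)
  PQ a b = 𝕊.trans (∑ᴾ.∑-cong λ v → 𝕊.sym (constP-* (p a v) (q v b)))
    (𝕊.trans (𝕊.sym (constP-∑ (λ v → p a v * q v b))) (constP-cong (∑pq a b)))

  -- Packs a recurrence between coefficients and its initial value into one identity of series;
  -- multiplication by `tP` is the index shift.
  resolvent-step : ∀ (x y d z : PS) → x 0 ≈ d 0 → (∀ n → d (suc n) ≈ 0#) → (∀ n → x (suc n) + y n ≈ z n) →
    (x +ₚ (tP *ₚ y)) ≋ (d +ₚ (tP *ₚ z))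
  resolvent-step x y d z eq₀ d≈0 eq = coefficientwise λ
    { zero → +-cong eq₀ (trans (tP-*ₚ-zero y) (sym (tP-*ₚ-zero z)))
    ; (suc n) → begin
        x (suc n) + (tP *ₚ y) (suc n)    ≈⟨ +-congˡ (tP-*ₚ-suc y n) ⟩
        x (suc n) + y n                  ≈⟨ eq n ⟩
        z n                              ≈⟨ +-identityˡ _ ⟨
        0# + z n                         ≈⟨ +-cong (d≈0 n) (tP-*ₚ-suc z n) ⟨
        d (suc n) + (tP *ₚ z) (suc n)    ∎ }

  open Resolvent powerSeriesRing (lookup (allArcs G)) nV

  s+t²≈1 : (oneMinusT² +ₚ (tP *ₚ tP)) ≋ constP 1#
  s+t²≈1 = 𝕊.trans (𝕊.+-congˡ (*ₚ-congˡ tP (𝕊.sym (𝕊.*-identityʳ tP)))) (cancel (constP 1#) (tP *ₚ (tP *ₚ constP 1#)))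
    where
    cancel : ∀ f g → ((f -ₚ g) +ₚ g) ≋ f
    cancel f g = coefficientwise λ n → solve 2 (λ x y → (x :- y) :+ y := x) refl (f n) (g n)

  resolventData : ResolventData
  resolventData = record
    { inv = invA G
    ; inv-involutive = invA-involutive G
    ; Σₐ-inv = Σᴾ.Σₐ-inv
    ; δₐ = Σᴾ.δₐ
    ; δₐ-sum = Σᴾ.δₐ-sum
    ; δₐ-sym = Σᴾ.δₐ-sym
    ; δₐ-inv = Σᴾ.δₐ-inv
    ; δᵥ = Σᴾ.δᵥ
    ; δᵥ-sum = Σᴾ.δᵥ-sum
    ; δᵥ-sym = Σᴾ.δᵥ-sym
    ; t = tP
    ; s = oneMinusT²
    ; s+t²≈1 = s+t²≈1
    ; P = P
    ; Q = Q
    ; X = X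
    ; resolventˡ = λ a b → resolvent-step (X a b) (X (invA G a) b) (Σᴾ.δₐ a b) (Σᴾ.Σₐ (λ c → ∑ᴾ.∑ (λ v → P a v *ₚ Q v c) *ₚ X c b))
        (sym (at (χ-constP (_≟A_ G a b)) 0)) (λ n → at (χ-constP (_≟A_ G a b)) (suc n))
        (λ n → trans (Θ-recurrenceˡ n a b) (sym (trans (Σₐ-coefficient _ n) (Σᴿ.Σₐ-cong λ c →
          trans (at (*ₚ-congʳ (X c b) (PQ a c)) n) (constP-*ₚ (U a c) (X c b) n)))))
    ; resolventʳ = λ a b → resolvent-step (X a b) (X a (invA G b)) (Σᴾ.δₐ a b) (Σᴾ.Σₐ (λ c → X a c *ₚ ∑ᴾ.∑ (λ v → P c v *ₚ Q v b)))
        (sym (at (χ-constP (_≟A_ G a b)) 0)) (λ n → at (χ-constP (_≟A_ G a b)) (suc n))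
        (λ n → trans (Θ-recurrenceʳ n a b) (sym (trans (Σₐ-coefficient _ n) (Σᴿ.Σₐ-cong λ c →
          trans (at (*ₚ-congˡ (X a c) (PQ c b)) n) (trans (*ₚ-comm (X a c) (constP (U c b)) n) (trans (constP-*ₚ (U c b) (X a c) n) (*-comm _ _)))))))
    }

  open Woodbury resolventData using (M; EM; EMW; Q[_]; PJ; trX; trδₐ; trδᵥ; s*EM; trEMW)

  Q[P]-constP : ∀ u v → constP (Aθ G τ₁ τ₂ u v) ≋ Q[ P ] u v
  Q[P]-constP u v = 𝕊.trans (constP-cong (Aθ-qp u v)) (𝕊.trans (constP-Σₐ _) (Σᴾ.Σₐ-cong λ a → constP-* _ _))

  Q[PJ]-constP : ∀ u v → constP (Dθ G τ₁ τ₂ u v) ≋ Q[ PJ ] u v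
  Q[PJ]-constP u v = 𝕊.trans (constP-cong (Dθ-qp u v)) (𝕊.trans (constP-Σₐ _) (Σᴾ.Σₐ-cong λ a → constP-* _ _))

  euler-constant : ∀ {x f} → constP x ≋ f → euler f ≋ constP 0#
  euler-constant {x} {f} eq = 𝕊.trans (E-cong {f} {constP x} (𝕊.sym eq)) (euler-constP x)

  Mθ≋M : ∀ u v → Mθ G τ₁ τ₂ u v ≋ M u v
  Mθ≋M u v = 𝕊.trans
    (𝕊.+-cong (𝕊.+-cong (𝕊.sym δ≋) (𝕊.-‿cong (*ₚ-congˡ tP (Q[P]-constP u v))))
      (*ₚ-congˡ (tP ^ₚ 2) (𝕊.trans (constP-+ _ _) (𝕊.+-cong (Q[PJ]-constP u v) (𝕊.trans (constP-neg _) (𝕊.-‿cong (𝕊.sym δ≋)))))))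
    (LD.pencil tP oneMinusT² s+t²≈1 euler-tP (Σᴾ.δᵥ u v) (Q[ P ] u v) (Q[ PJ ] u v))
    where
    δ≋ : Σᴾ.δᵥ u v ≋ constP (δ ⌊ u ≟F v ⌋)
    δ≋ = χ-constP (u ≟F v)

  euler-M : ∀ u v → euler (M u v) ≋ EM u v
  euler-M u v = LD.E-pencil tP oneMinusT² s+t²≈1 euler-tP (Σᴾ.δᵥ u v) (Q[ P ] u v) (Q[ PJ ] u v)
    (euler-constant (𝕊.sym (χ-constP (u ≟F v)))) (euler-constant (Q[P]-constP u v)) (euler-constant (Q[PJ]-constP u v))

  LogD-det : LD.LogD oneMinusT² (det nV (Mθ G τ₁ τ₂)) (∑ᴾ.∑ (λ u → EMW u u))
  LogD-det = LD.LogD-cong {oneMinusT²} {Detᴾ.det nV M} {det nV (Mθ G τ₁ τ₂)} {∑ᴾ.∑ (λ u → EMW u u)}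
    (𝕊.sym (𝕊.trans (det-Determinant nV (Mθ G τ₁ τ₂)) (Detᴾ.det-cong nV Mθ≋M))) 𝕊.refl
    (jacobi nV M EMW oneMinusT² (λ u v → 𝕊.trans (*ₚ-congˡ oneMinusT² (euler-M u v)) (s*EM u v)))

  -- At t = 0 the matrix is the identity, and only the first term of the expansion survives.
  det-constant-term : ∀ n (M : Fin n → Fin n → PS) → (∀ i j → M i j 0 ≈ χᴿ.χ (i ≟F j)) → det n M 0 ≈ 1#
  det-constant-term zero    M M₀ = refl
  det-constant-term (suc n) M M₀ = begin
    det (suc n) M 0                    ≈⟨ trans (at (sumFP-∑ (suc n) term) 0) (∑-coefficient term 0) ⟩
    ∑ᴿ.∑ (λ j → term j 0)              ≈⟨ ∑ᴿ.∑-single zero _ off ⟩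
    term zero 0                        ≈⟨ term₀ zero ⟩
    1# * M zero zero 0 * D zero 0      ≈⟨ *-cong (trans (*-identityˡ _) (M₀ zero zero)) (det-constant-term n _ λ r s →
                                            trans (M₀ (suc r) (suc s)) (χᴿ.χ-⇔ (suc r ≟F suc s) (r ≟F s) suc-injectiveF (≡.cong suc))) ⟩
    1# * 1#                            ≈⟨ *-identityˡ _ ⟩
    1#                                 ∎
    where
    D = λ j → det n (Detᴾ.minor j M)
    term = λ j → constP (sgn (toℕ j)) *ₚ M zero j *ₚ D j
    term₀ : ∀ j → term j 0 ≈ sgn (toℕ j) * M zero j 0 * D j 0
    term₀ j = trans (*ₚ-zero (constP (sgn (toℕ j)) *ₚ M zero j) (D j)) (*-congʳ (*ₚ-zero (constP (sgn (toℕ j))) (M zero j)))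
    off : ∀ j → j ≡.≢ zero → term j 0 ≈ 0#
    off j j≢0 = trans (term₀ j) (trans (*-congʳ (trans (*-congˡ (trans (M₀ zero j)
      (χᴿ.χ-no (zero ≟F j) (λ eq → j≢0 (≡.sym eq))))) (zeroʳ _))) (zeroˡ _))

  tP²-*ₚ-zero : ∀ f → (tP ^ₚ 2 *ₚ f) 0 ≈ 0#
  tP²-*ₚ-zero f = trans (*ₚ-zero (tP ^ₚ 2) f) (trans (*-congʳ (tP-*ₚ-zero (tP *ₚ constP 1#))) (zeroˡ _))

  Mθ-constant-term : ∀ u v → Mθ G τ₁ τ₂ u v 0 ≈ χᴿ.χ (u ≟F v)
  Mθ-constant-term u v = begin
    x - (tP *ₚ constP (Aθ G τ₁ τ₂ u v)) 0 + (tP ^ₚ 2 *ₚ constP (Dθ G τ₁ τ₂ u v - x)) 0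
      ≈⟨ +-cong (+-congˡ (-‿cong (tP-*ₚ-zero (constP (Aθ G τ₁ τ₂ u v))))) (tP²-*ₚ-zero (constP (Dθ G τ₁ τ₂ u v - x))) ⟩
    x - 0# + 0#        ≈⟨ solve 2 (λ x z → x :- z :+ z := x) refl x 0# ⟩
    x                  ∎
    where x = δ ⌊ u ≟F v ⌋

  s₀ : oneMinusT² 0 ≈ 1#
  s₀ = begin
    1# - (tP *ₚ (tP *ₚ constP 1#)) 0     ≈⟨ +-congˡ (-‿cong (tP-*ₚ-zero (tP *ₚ constP 1#))) ⟩
    1# - 0#                              ≈⟨ +-identityʳ _ ⟨
    1# - 0# + 0#                         ≈⟨ solve 2 (λ x z → x :- z :+ z := x) refl 1# 0# ⟩
    1#                                   ∎

  s^₀ : ∀ k → (oneMinusT² ^ₚ k) 0 ≈ 1#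
  s^₀ zero    = refl
  s^₀ (suc k) = trans (*ₚ-zero oneMinusT² (oneMinusT² ^ₚ k)) (trans (*-cong s₀ (s^₀ k)) (*-identityˡ _))

  open import Algebra.Properties.Semiring.Mult 𝕊.semiring using () renaming (_×_ to _·_)

  w : PS
  w = LD.w tP oneMinusT² s+t²≈1 euler-tP

  LogD-s^ : ∀ k → LD.LogD oneMinusT² (oneMinusT² ^ₚ k) (k · w)
  LogD-s^ zero    = LD.LogD-1 {oneMinusT²}
  LogD-s^ (suc k) = LD.LogD-* {oneMinusT²} {oneMinusT²} {oneMinusT² ^ₚ k} {w} {k · w}
    (LD.LogD-s tP oneMinusT² s+t²≈1 euler-tP) (LogD-s^ k)

  k·w₀ : ∀ k → (k · w) 0 ≈ 0#
  k·w₀ zero    = refl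
  k·w₀ (suc k) = trans (+-cong w₀ (k·w₀ k)) (+-identityʳ _)
    where
    w₀ : w 0 ≈ 0#
    w₀ = trans (-‿cong (+-cong (tP-*ₚ-zero tP) (tP-*ₚ-zero tP))) (trans (-‿cong (+-identityʳ 0#))
      (trans (sym (+-identityˡ _)) (-‿inverseʳ 0#)))

  module _ (inverse : ∀ k → fromℕ (suc k) * inv k ≈ 1#) where

    -- `E` cancels the denominator `k`, leaving the trace of Θᵏ at tᵏ for positive `k`. The constant
    -- term of `trX` is the number of arcs, which has no counterpart in `logZ`; subtracting `trδₐ`
    -- removes it.
    euler-logZ : euler (logZ G τ₁ τ₂) ≋ (trX -ₚ trδₐ)
    euler-logZ = coefficientwise λ
      { zero → begin
          0# * 0#                                    ≈⟨ zeroˡ _ ⟩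
          0#                                         ≈⟨ -‿inverseʳ _ ⟨
          trδₐ 0 - trδₐ 0                            ≈⟨ +-congʳ (trans (Σₐ-coefficient _ 0)
                                                         (trans (Σᴿ.Σₐ-cong λ a → at (χ-constP (_≟A_ G a a)) 0) (sym (Σₐ-coefficient _ 0)))) ⟩
          trX 0 - trδₐ 0                             ∎
      ; (suc k) → begin
          fromℕ (suc k) * (N G τ₁ τ₂ (suc k) * inv k)    ≈⟨ solve 3 (λ k n i → k :* (n :* i) := (k :* i) :* n) refl (fromℕ (suc k)) (N G τ₁ τ₂ (suc k)) (inv k) ⟩
          fromℕ (suc k) * inv k * N G τ₁ τ₂ (suc k)      ≈⟨ trans (*-congʳ (inverse k)) (*-identityˡ _) ⟩
          N G τ₁ τ₂ (suc k)                              ≈⟨ N-trace k ⟩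
          Σᴿ.Σₐ (λ a → Θ^ (suc k) a a)                   ≈⟨ Σₐ-coefficient _ (suc k) ⟨
          trX (suc k)                                    ≈⟨ solve 2 (λ x z → x := x :- z :+ z) refl (trX (suc k)) 0# ⟩
          trX (suc k) - 0# + 0#                          ≈⟨ +-identityʳ _ ⟩
          trX (suc k) - 0#                               ≈⟨ +-congˡ (-‿cong (trδₐ-suc k)) ⟨
          trX (suc k) - trδₐ (suc k)                     ∎ }
      where
      trδₐ-suc : ∀ k → trδₐ (suc k) ≈ 0#
      trδₐ-suc k = begin
        trδₐ (suc k)                                 ≈⟨ Σₐ-coefficient _ (suc k) ⟩
        -- Zero is written as `0# * 0#` so that a factor zero can be taken out of the sum.
        Σᴿ.Σₐ (λ a → Σᴾ.δₐ a a (suc k))              ≈⟨ Σᴿ.Σₐ-cong (λ a → trans (at (χ-constP (_≟A_ G a a)) (suc k)) (sym (zeroˡ 0#))) ⟩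
        Σᴿ.Σₐ (λ a → 0# * 0#)                        ≈⟨ Σᴿ.*-Σₐ 0# _ ⟨
        0# * Σᴿ.Σₐ (λ a → 0#)                        ≈⟨ zeroˡ _ ⟩
        0#                                           ∎

    LogD-Z : LD.LogD oneMinusT² (Z G τ₁ τ₂) (oneMinusT² *ₚ (trX -ₚ trδₐ))
    LogD-Z = 𝕊.trans
      (*ₚ-congˡ oneMinusT² (𝕊.trans (euler-expP inverse (logZ G τ₁ τ₂) refl) (*ₚ-congʳ (Z G τ₁ τ₂) euler-logZ)))
      (𝕊.sym (𝕊.*-assoc oneMinusT² (trX -ₚ trδₐ) (Z G τ₁ τ₂)))

    determinant-formula :
      (Z G τ₁ τ₂ *ₚ (oneMinusT² ^ₚ (nE ∸ nV) *ₚ det nV (Mθ G τ₁ τ₂))) ≋ (oneMinusT² ^ₚ (nV ∸ nE))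
    determinant-formula = euler-unique inverse oneMinusT² ((nV ∸ nE) · w)
      lhs (oneMinusT² ^ₚ (nV ∸ nE)) s₀ (k·w₀ (nV ∸ nE)) constant-terms
      (LD.LogD-cong {oneMinusT²} {lhs} {lhs} 𝕊.refl
        -- The numerators contributed by `Z`, by the power of `s` and by the determinant add up to
        -- that of the right side.
        (LD.exponents tP oneMinusT² s+t²≈1 euler-tP nE nV trace trX trδₐ trδᵥ trEMW
          (𝕊.trans Σᴾ.trδₐ-edges (∑ᴾ.∑-const nE _))
          (𝕊.trans (∑ᴾ.∑-cong λ v → χᴾ.χ-yes (v ≟F v) ≡.refl) (∑ᴾ.∑-const nV _)))
        (LD.LogD-* {oneMinusT²} {Z G τ₁ τ₂} {cofactor} {oneMinusT² *ₚ (trX -ₚ trδₐ)} {(nE ∸ nV) · w +ₚ trace} LogD-Z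
          (LD.LogD-* {oneMinusT²} {oneMinusT² ^ₚ (nE ∸ nV)} {det nV (Mθ G τ₁ τ₂)} {(nE ∸ nV) · w} {trace} (LogD-s^ (nE ∸ nV)) LogD-det)))
      (LogD-s^ (nV ∸ nE))
      where
      cofactor = oneMinusT² ^ₚ (nE ∸ nV) *ₚ det nV (Mθ G τ₁ τ₂)
      lhs = Z G τ₁ τ₂ *ₚ cofactor
      trace = ∑ᴾ.∑ (λ u → EMW u u)
      constant-terms : lhs 0 ≈ (oneMinusT² ^ₚ (nV ∸ nE)) 0
      constant-terms = begin
        lhs 0
          ≈⟨ trans (*ₚ-zero (Z G τ₁ τ₂) cofactor) (*-congˡ (*ₚ-zero (oneMinusT² ^ₚ (nE ∸ nV)) (det nV (Mθ G τ₁ τ₂)))) ⟩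
        Z G τ₁ τ₂ 0 * ((oneMinusT² ^ₚ (nE ∸ nV)) 0 * det nV (Mθ G τ₁ τ₂) 0)
          ≈⟨ *-cong (trans (+-identityʳ _) (*-identityˡ _))
               (*-cong (s^₀ (nE ∸ nV)) (det-constant-term nV (Mθ G τ₁ τ₂) Mθ-constant-term)) ⟩
        1# * (1# * 1#)
          ≈⟨ trans (*-identityˡ _) (*-identityˡ _) ⟩
        1#
          ≈⟨ s^₀ (nV ∸ nE) ⟨
        (oneMinusT² ^ₚ (nV ∸ nE)) 0 ∎

theorem3p7 : ∀ {c ℓ} (R : CommutativeRing c ℓ) (inv : ℕ → CommutativeRing.Carrier R)
    → (∀ k → CommutativeRing._≈_ R (CommutativeRing._*_ R (Zeta.fromℕ R inv (suc k)) (inv k)) (CommutativeRing.1# R))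
    → (G : Graph) (τ₁ τ₂ : Arc G → CommutativeRing.Carrier R)
    → let open Zeta R inv in
    Z G τ₁ τ₂ *ₚ (oneMinusT² ^ₚ (Graph.nE G ∸ Graph.nV G) *ₚ det (Graph.nV G) (Mθ G τ₁ τ₂))
    ≈ₚ oneMinusT² ^ₚ (Graph.nV G ∸ Graph.nE G)
theorem3p7 R inv inverse G τ₁ τ₂ = PowerSeries._≋_.at (WeightedZeta.determinant-formula R inv G τ₁ τ₂ inverse)
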